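{- Let $D=(V,A)$ be a finite directed graph, $\{S,T\}$ a partition of $V$ into nonempty sets with no arc $uv\in A$ having $u\in T$, $v\in S$, and $w\in\mathbb{Z}_+^{A}$. Let $x\in\{0,1\}^A$ be an optimal solution of the linear program (P) and let $(y,z)\in \mathbb{Z}^{2^S\setminus\{\emptyset\}}\times\mathbb{Z}^{2^T\setminus\{\emptyset\}}$ be an optimal solution of its dual (D). Define $\xi^*\in\{0,1\}^{A[S,T]}$, $p^*\in\mathbb{Z}^S$, $q^*\in\mathbb{Z}^T$ by $$\xi^*(a)=x(a)\ (a\in A[S,T]),\qquad p^*(u)=-\sum_{S'\subseteq S,\ u\in S'}y(S')\ (u\in S),\qquad q^*(v)=\sum_{T'\subseteq T,\ v\in T'}z(T')\ (v\in T).$$ Then $\xi^*$ is an optimal flow for (MSF) and $(p^*,q^*)$ is an optimal potential for (MSF).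
   Context: Notation: an arc $uv$ leaves $u$ and enters $v$. For $X\subseteq V$, $\delta^+X=\{uv\in A: u\in X, v\notin X\}$, $\delta^-X=\{uv\in A: u\notin X, v\in X\}$; $\delta^{\pm}u=\delta^{\pm}\{u\}$. $A[X]$ denotes arcs with both ends in $X$, $A[S,T]=\{uv\in A: u\in S, v\in T\}$, so $A=A[S]\cup A[T]\cup A[S,T]$; $D[S]=(S,A[S])$, $D[T]=(T,A[T])$. (P): minimize $\sum_{a\in A}w(a)x(a)$ over $x\in\mathbb{R}^A$ subject to $\sum_{a\in\delta^+S'}x(a)\ge1$ for all $\emptyset\ne S'\subseteq S$, $\sum_{a\in\delta^-T'}x(a)\ge1$ for all $\emptyset\ne T'\subseteq T$, $x\ge0$. (D): maximize $\sum_{\emptyset\ne S'\subseteq S}y(S')+\sum_{\emptyset\ne T'\subseteq T}z(T')$ subject to $\sum_{S'\subseteq S,\,a\in\delta^+S'}y(S')+\sum_{T'\subseteq T,\,a\in\delta^-T'}z(T')\le w(a)$ for all $a\in A$, and $y\ge0$, $z\ge0$. A branching is an arc set with no directed cycle in which every vertex is entered by at most one arc; for a branching $B$ in $D[T]$, $R(B)$ is the set of vertices of $T$ entered by no arc of $B$. A cobranching is an arc set whose reversal is a branching; for a cobranching $B$ in $D[S]$, $R^*(B)$ is the set of vertices of $S$ left by no arc of $B$. For $\eta\in\mathbb{Z}^X$, $\mathrm{supp}^+(\eta)=\{u\in X:\eta(u)>0\}$. Define $g_T:\mathbb{Z}^T\to\mathbb{Z}\cup\{+\infty\}$ by $g_T(\eta)=\min\{w(B):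 B \text{ branching in } D[T],\ R(B)=\mathrm{supp}^+(\eta)\}$ if $\eta\in\mathbb{Z}_+^T$ and such a branching exists, and $g_T(\eta)=+\infty$ otherwise; define $g_S:\mathbb{Z}^S\to\mathbb{Z}\cup\{+\infty\}$ analogously using cobranchings $B$ in $D[S]$ with $R^*(B)=\mathrm{supp}^+(\eta)$, $\eta\in\mathbb{Z}_+^S$. $\mathrm{dom}\,g=\{\eta: g(\eta)<+\infty\}$. For $\xi\in\{0,1\}^{A[S,T]}$ let $\partial\xi(v)=|\{a\in\delta^+v:\xi(a)=1\}|-|\{a\in\delta^-v:\xi(a)=1\}|$ for $v\in V$ (only arcs of $A[S,T]$ counted), with restrictions $\partial\xi|_S$, $\partial\xi|_T$. $\xi$ is feasible if $\partial\xi|_S\in\mathrm{dom}\,g_S$ and $-\partial\xi|_T\in\mathrm{dom}\,g_T$. Problem (MSF): minimize $\sum_{a\in A[S,T]}w(a)\xi(a)+g_S(\partial\xi|_S)+g_T(-\partial\xi|_T)$ over $\xi\in\{0,1\}^{A[S,T]}$; an optimal flow is a feasible $\xi$ attaining the minimum. For $p\in\mathbb{Z}^S$, $q\in\mathbb{Z}^T$ let $g_S[-p](\eta)=g_S(\eta)-\sum_{u\in S}p(u)\eta(u)$ and $g_T[+q](\zeta)=g_T(\zeta)+\sum_{v\in T}q(v)\zeta(v)$. A pair $(p,q)\in\mathbb{Z}^S\times\mathbb{Z}^T$ is an optimal potential for (MSF) if there is a feasible $\xi\in\{0,1\}^{A[S,T]}$ such that: (i) for every $a=uv\in A[S,T]$,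 $\xi(a)=1\Rightarrow w(a)+p(u)-q(v)\le0$ and $\xi(a)=0\Rightarrow w(a)+p(u)-q(v)\ge0$; (ii) $\partial\xi|_S\in\arg\min g_S[-p]$; (iii) $-\partial\xi|_T\in\arg\min g_T[+q]$. -}

module Defs where

open import Data.Bool using (Bool; true; false; _∧_; _∨_; not; if_then_else_)
open import Data.Nat as ℕ using (ℕ; zero; suc)
open import Data.Integer as ℤ using (ℤ; +_; 0ℤ)
open import Data.Rational as ℚ using (ℚ; 0ℚ; 1ℚ)
open import Data.Fin using (Fin; _≟_)
open import Data.Fin.Subset using (Subset)
open import Data.List using (List; []; _∷_; map; foldr; allFin; filter; _++_)
open import Data.Vec using (lookup; _∷_; [])
open import Data.Product using (Σ; ∃; _×_; _,_)
open import Relation.Binary.PropositionalEquality using (_≡_; _≢_)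
open import Relation.Nullary using (¬_; does)

-- The data: a finite digraph D = (V,A) with V = Fin n, A = Fin m,
-- arc a leaves tl a and enters hd a (parallel arcs allowed);
-- side v ≡ true means v ∈ S, side v ≡ false means v ∈ T;
-- integer weights w ∈ ℤ₊^A.

record Net : Set where
  field
    n m  : ℕ
    tl hd : Fin m → Fin n
    side : Fin n → Bool
    w    : Fin m → ℕ
open Net public

inS inT : (G : Net) → Fin (n G) → Bool
inS G v = side G v
inT G v = not (side G v)

isST : (G : Net) → Fin (m G) → Bool
isST G a = inS G (tl G a) ∧ inT G (hd G a)

sumℤ : List ℤ → ℤ
sumℤ = foldr ℤ._+_ 0ℤ

sumℚ : List ℚ → ℚ
sumℚ = foldr ℚ._+_ 0ℚ

Σℤ[_∣_] : ∀ {k} → (Fin k → Bool) → (Fin k → ℤ) → ℤ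
Σℤ[ P ∣ f ] = sumℤ (map (λ i → if P i then f i else 0ℤ) (allFin _))

Σℚ[_∣_] : ∀ {k} → (Fin k → Bool) → (Fin k → ℚ) → ℚ
Σℚ[ P ∣ f ] = sumℚ (map (λ i → if P i then f i else 0ℚ) (allFin _))

toℚ : ℤ → ℚ
toℚ z = z ℚ./ 1

bℤ : Bool → ℤ
bℤ true  = + 1
bℤ false = 0ℤ

bℚ : Bool → ℚ
bℚ true  = 1ℚ
bℚ false = 0ℚ

_==_ : ∀ {k} → Fin k → Fin k → Bool
i == j = does (i ≟ j)

allSubsets : (k : ℕ) → List (Subset k)
allSubsets zero    = [] ∷ []
allSubsets (suc k) = map (true ∷_) (allSubsets k) ++ map (false ∷_) (allSubsets k)

anyᵇ allᵇ : ∀ {A : Set} → (A → Bool) → List A → Bool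
anyᵇ P = foldr (λ a b → P a ∨ b) false
allᵇ P = foldr (λ a b → P a ∧ b) true

_∈ᵇ_ : ∀ {k} → Fin k → Subset k → Bool
v ∈ᵇ X = lookup X v

validS validT : (G : Net) → Subset (n G) → Bool
validS G X = anyᵇ (_∈ᵇ X) (allFin _) ∧ allᵇ (λ v → not (v ∈ᵇ X) ∨ inS G v) (allFin _)
validT G X = anyᵇ (_∈ᵇ X) (allFin _) ∧ allᵇ (λ v → not (v ∈ᵇ X) ∨ inT G v) (allFin _)

Σℤ⟦_∣_⟧ : ∀ {k} → (Subset k → Bool) → (Subset k → ℤ) → ℤ
Σℤ⟦ P ∣ f ⟧ = sumℤ (map (λ X → if P X then f X else 0ℤ) (allSubsets _))

Σℚ⟦_∣_⟧ : ∀ {k} → (Subset k → Bool) → (Subset k → ℚ) → ℚ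
Σℚ⟦ P ∣ f ⟧ = sumℚ (map (λ X → if P X then f X else 0ℚ) (allSubsets _))

outOf into : (G : Net) → Subset (n G) → Fin (m G) → Bool
outOf G X a = (tl G a ∈ᵇ X) ∧ not (hd G a ∈ᵇ X)
into  G X a = not (tl G a ∈ᵇ X) ∧ (hd G a ∈ᵇ X)

PFeasible : (G : Net) → (Fin (m G) → ℚ) → Set
PFeasible G x =
  (∀ X → validS G X ≡ true → 1ℚ ℚ.≤ Σℚ[ outOf G X ∣ x ]) ×
  (∀ X → validT G X ≡ true → 1ℚ ℚ.≤ Σℚ[ into G X ∣ x ]) ×
  (∀ a → 0ℚ ℚ.≤ x a)

Pcost : (G : Net) → (Fin (m G) → ℚ) → ℚ
Pcost G x = Σℚ[ (λ _ → true) ∣ (λ a → toℚ (+ w G a) ℚ.* x a) ]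

POptimal : (G : Net) → (Fin (m G) → ℚ) → Set
POptimal G x = PFeasible G x × (∀ x′ → PFeasible G x′ → Pcost G x ℚ.≤ Pcost G x′)

-- y is indexed by nonempty S' ⊆ S, z by nonempty T' ⊆ T; values of
-- y, z on other subsets of V play no role.
DFeasible : (G : Net) → (Subset (n G) → ℚ) → (Subset (n G) → ℚ) → Set
DFeasible G y z =
  (∀ a → Σℚ⟦ (λ X → validS G X ∧ outOf G X a) ∣ y ⟧ ℚ.+ Σℚ⟦ (λ X → validT G X ∧ into G X a) ∣ z ⟧
          ℚ.≤ toℚ (+ w G a)) ×
  (∀ X → validS G X ≡ true → 0ℚ ℚ.≤ y X) ×
  (∀ X → validT G X ≡ true → 0ℚ ℚ.≤ z X)

Dobj : (G : Net) → (Subset (n G) → ℚ) → (Subset (n G) → ℚ) → ℚ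
Dobj G y z = Σℚ⟦ validS G ∣ y ⟧ ℚ.+ Σℚ⟦ validT G ∣ z ⟧

DOptimal : (G : Net) → (Subset (n G) → ℚ) → (Subset (n G) → ℚ) → Set
DOptimal G y z = DFeasible G y z ×
  (∀ y′ z′ → DFeasible G y′ z′ → Dobj G y′ z′ ℚ.≤ Dobj G y z)

ArcSet : Net → Set
ArcSet G = Fin (m G) → Bool

data Walk (G : Net) (src tgt : Fin (m G) → Fin (n G)) (B : ArcSet G)
     : Fin (n G) → Fin (n G) → Set where
  stay : ∀ {u} → Walk G src tgt B u u
  step : ∀ {v} a → B a ≡ true → Walk G src tgt B (tgt a) v → Walk G src tgt B (src a) v

IsBranching : (G : Net) → (src tgt : Fin (m G) → Fin (n G)) → ArcSet G → Set
IsBranching G src tgt B =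
  (∀ a → B a ≡ true → ¬ Walk G src tgt B (tgt a) (src a)) ×
  (∀ a a′ → B a ≡ true → B a′ ≡ true → tgt a ≡ tgt a′ → a ≡ a′)

Unentered : (G : Net) → (tgt : Fin (m G) → Fin (n G)) → ArcSet G → Fin (n G) → Set
Unentered G tgt B v = ∀ a → B a ≡ true → tgt a ≢ v

_⇔′_ : Set → Set → Set
P ⇔′ Q = (P → Q) × (Q → P)

BranchT : (G : Net) → ArcSet G → (Fin (n G) → ℤ) → Set
BranchT G B η =
  (∀ a → B a ≡ true → (inT G (tl G a) ≡ true × inT G (hd G a) ≡ true)) ×
  IsBranching G (tl G) (hd G) B ×
  (∀ v → inT G v ≡ true → (Unentered G (hd G) B v ⇔′ (0ℤ ℤ.< η v)))

CobranchS : (G : Net) → ArcSet G → (Fin (n G) → ℤ) → Set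
CobranchS G B η =
  (∀ a → B a ≡ true → (inS G (tl G a) ≡ true × inS G (hd G a) ≡ true)) ×
  IsBranching G (hd G) (tl G) B ×
  (∀ u → inS G u ≡ true → (Unentered G (tl G) B u ⇔′ (0ℤ ℤ.< η u)))

wB : (G : Net) → ArcSet G → ℤ
wB G B = Σℤ[ B ∣ (λ a → + w G a) ]

-- g_T η ≡ c (finite value c).  Vectors η ∈ ℤ^T are represented by
-- η : Fin n → ℤ whose entries at vertices of S are ignored.
GT : (G : Net) → (Fin (n G) → ℤ) → ℤ → Set
GT G η c =
  (∀ v → inT G v ≡ true → 0ℤ ℤ.≤ η v) ×
  Σ (ArcSet G) (λ B → BranchT G B η × wB G B ≡ c ×
     (∀ B′ → BranchT G B′ η → c ℤ.≤ wB G B′))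

-- g_S η ≡ c (entries of η at vertices of T are ignored)
GS : (G : Net) → (Fin (n G) → ℤ) → ℤ → Set
GS G η c =
  (∀ u → inS G u ≡ true → 0ℤ ℤ.≤ η u) ×
  Σ (ArcSet G) (λ B → CobranchS G B η × wB G B ≡ c ×
     (∀ B′ → CobranchS G B′ η → c ℤ.≤ wB G B′))

-- (MSF).  A flow ξ ∈ {0,1}^{A[S,T]} is represented by ξ : Fin m → Bool;
-- only its values on arcs of A[S,T] are used.

Flow : Net → Set
Flow G = Fin (m G) → Bool

∂ : (G : Net) → Flow G → Fin (n G) → ℤ
∂ G ξ v = Σℤ[ (λ a → isST G a ∧ ξ a ∧ (tl G a == v)) ∣ (λ _ → + 1) ]
     ℤ.- Σℤ[ (λ a → isST G a ∧ ξ a ∧ (hd G a == v)) ∣ (λ _ → + 1) ]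

∂⁻ : (G : Net) → Flow G → Fin (n G) → ℤ
∂⁻ G ξ v = ℤ.- ∂ G ξ v

flowCost : (G : Net) → Flow G → ℤ
flowCost G ξ = Σℤ[ (λ a → isST G a ∧ ξ a) ∣ (λ a → + w G a) ]

Feasible : (G : Net) → Flow G → Set
Feasible G ξ = (∃ λ c → GS G (∂ G ξ) c) × (∃ λ c → GT G (∂⁻ G ξ) c)

OptimalFlow : (G : Net) → Flow G → Set
OptimalFlow G ξ =
  Σ ℤ λ cS → Σ ℤ λ cT → GS G (∂ G ξ) cS × GT G (∂⁻ G ξ) cT ×
  (∀ ξ′ cS′ cT′ → GS G (∂ G ξ′) cS′ → GT G (∂⁻ G ξ′) cT′ →
     flowCost G ξ ℤ.+ cS ℤ.+ cT ℤ.≤ flowCost G ξ′ ℤ.+ cS′ ℤ.+ cT′)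

dotS dotT : (G : Net) → (Fin (n G) → ℤ) → (Fin (n G) → ℤ) → ℤ
dotS G p η = Σℤ[ inS G ∣ (λ u → p u ℤ.* η u) ]
dotT G q ζ = Σℤ[ inT G ∣ (λ v → q v ℤ.* ζ v) ]

ArgMinS : (G : Net) → (p : Fin (n G) → ℤ) → (Fin (n G) → ℤ) → Set
ArgMinS G p η = Σ ℤ λ c → GS G η c ×
  (∀ η′ c′ → GS G η′ c′ → c ℤ.- dotS G p η ℤ.≤ c′ ℤ.- dotS G p η′)

ArgMinT : (G : Net) → (q : Fin (n G) → ℤ) → (Fin (n G) → ℤ) → Set
ArgMinT G q ζ = Σ ℤ λ c → GT G ζ c ×
  (∀ ζ′ c′ → GT G ζ′ c′ → c ℤ.+ dotT G q ζ ℤ.≤ c′ ℤ.+ dotT G q ζ′)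

-- p ∈ ℤ^S, q ∈ ℤ^T represented by functions on V (other entries ignored)
OptimalPotential : (G : Net) → (Fin (n G) → ℤ) → (Fin (n G) → ℤ) → Set
OptimalPotential G p q = Σ (Flow G) λ ξ → Feasible G ξ ×
  (∀ a → isST G a ≡ true →
     (ξ a ≡ true → (+ w G a) ℤ.+ p (tl G a) ℤ.- q (hd G a) ℤ.≤ 0ℤ) ×
     (ξ a ≡ false → 0ℤ ℤ.≤ (+ w G a) ℤ.+ p (tl G a) ℤ.- q (hd G a))) ×
  ArgMinS G p (∂ G ξ) ×
  ArgMinT G q (∂⁻ G ξ)

Admissible : Net → Set
Admissible G = (∃ λ u → inS G u ≡ true) × (∃ λ v → inT G v ≡ true) ×
  (∀ a → ¬ (inT G (tl G a) ≡ true × inS G (hd G a) ≡ true))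

pStar : (G : Net) → (Subset (n G) → ℤ) → Fin (n G) → ℤ
pStar G y u = ℤ.- Σℤ⟦ (λ X → validS G X ∧ (u ∈ᵇ X)) ∣ y ⟧

qStar : (G : Net) → (Subset (n G) → ℤ) → Fin (n G) → ℤ
qStar G z v = Σℤ⟦ (λ X → validT G X ∧ (v ∈ᵇ X)) ∣ z ⟧

Fin′ : Net → Set
Fin′ G = Fin (m G)

{-# OPTIONS --safe #-}
-- Fourier–Motzkin elimination gives strong duality for (P) and (D), so w(x) ≤ Y + Z with
-- Y = Σ y and Z = Σ z.  Conversely, a nonempty S' ⊆ S is left by an arc of any cobranching B of
-- D[S] or meets R*(B); charging y(S') there gives Y ≤ g_S[-p*](η) for every η, and likewise
-- Z ≤ g_T[+q*](ζ), while dual feasibility makes the reduced costs w(a) + p*(u) − q*(v) on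
-- A[S,T] nonnegative.  The constraints of (P) say that x ∩ A[S] and x ∩ A[T] contain a
-- cobranching and a branching whose root sets are the supports of the boundary of ξ*.  Together
-- with ξ* these cost at most w(x), so all the inequalities above hold with equality at ξ*: this
-- gives the values g_S(∂ξ*), g_T(−∂ξ*), the optimality of ξ* and conditions (i)–(iii).

module Submission where

open import Defs
open import Algebra.Structures using (IsCommutativeRing)
open import Data.Bool using (Bool; true; false; if_then_else_; _∧_; _∨_; not)
import Data.Bool.Properties as Bool
open import Data.Empty using (⊥; ⊥-elim)
open import Data.Fin using (Fin; zero; suc; toℕ; _≟_)
import Data.Fin.Properties as Fin
open import Data.Fin.Subset using (Subset; ∣_∣)
open import Data.Integer as ℤ using (ℤ; 0ℤ; 1ℤ)
import Data.Integer.Properties as ℤ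
open import Data.List as List using (List; []; _∷_; _++_; foldr; allFin; cartesianProductWith)
open import Data.List.Membership.Propositional using (_∈_)
open import Data.List.Membership.Propositional.Properties using (∈-++⁺ˡ; ∈-++⁺ʳ; ∈-++⁻; ∈-map⁺; ∈-map⁻; ∈-allFin; ∈-cartesianProductWith⁺; ∈-cartesianProductWith⁻)
open import Data.List.Properties using (map-tabulate)
open import Data.List.Relation.Unary.Any using (here; there)
open import Data.Nat as ℕ using (ℕ; zero; suc)
open import Data.Nat.Induction using (Acc; acc; <-wellFounded)
import Data.Nat.Properties as ℕ
open import Data.Product using (∃-syntax; _×_; _,_; proj₁; proj₂)
open import Data.Rational as ℚ using (ℚ; 0ℚ; 1ℚ)
import Data.Rational.Properties as ℚ
import Data.Rational.Unnormalised as ℚᵘ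
import Data.Rational.Unnormalised.Properties as ℚᵘ
open import Data.Sum using (_⊎_; inj₁; inj₂)
open import Data.Vec as Vec using (Vec; []; _∷_; lookup; tabulate; _[_]≔_)
open import Data.Vec.Properties using (lookup∘tabulate; lookup∘update; lookup∘update′; lookup-zipWith; lookup-map; lookup-replicate)
open import Function using (_∘_; id)
open import Level using (0ℓ)
open import Relation.Binary using (Rel; tri<; tri≈; tri>)
open import Relation.Binary.PropositionalEquality using (_≡_; _≢_; refl; sym; trans; cong; cong₂; subst; subst₂)
open import Relation.Nullary using (yes; no; ¬_; does; contradiction; _×-dec_)

-- What has to be excluded in the duality step is a Farkas certificate `(u , t)`: nonnegative
-- weights `u` on the rows of (P) and `t` on the bound w(x) ≤ Y + Z. As `t` may be 0, dividing by it
-- would call for a separate treatment of unbounded dual rays; merging the certificate with the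
-- given dual optimum into (u + y) / (1 + t) handles both cases at once. The primal solution so
-- obtained is only rational, which is enough because `x` is optimal among all rational solutions.
-- The rest is the identity c + bS + bT = (bS - dS) + (bT + dT) + (c + dS - dT), where c is the flow
-- cost, bS and bT are the weights of a cobranching and a branching, and dS = p*·∂ξ, dT = q*·(-∂ξ).
-- The brackets are at least Y, Z and 0, so a total of at most Y + Z makes all three tight. Root
-- sets see only the support of η; integrality closes the gap, since a positive η(v) is at least 1
-- and so pays for every dual set charged to v.

-- Finite sums, shared by ℤ and ℚ

module FiniteSums
  {C : Set} (_+_ _*_ : C → C → C) (-_ : C → C) (0# 1# : C)
  (isCommutativeRing : IsCommutativeRing {A = C} _≡_ _+_ _*_ -_ 0# 1#)
  (_≤_ : Rel C 0ℓ) (≤-refl : ∀ {c} → c ≤ c)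
  (+-mono-≤ : ∀ {a b c d} → a ≤ b → c ≤ d → (a + c) ≤ (b + d))
  where

  open IsCommutativeRing isCommutativeRing
    using (+-identityˡ; +-identityʳ; +-assoc; +-comm; *-comm; *-identityˡ; zeroˡ; zeroʳ; distribˡ)

  ∑ : {I : Set} → List I → (I → C) → C
  ∑ is f = foldr _+_ 0# (List.map f is)

  private variable
    I J : Set

  ∑-cong : (is : List I) {f g : I → C} → (∀ i → f i ≡ g i) → ∑ is f ≡ ∑ is g
  ∑-cong []       f≡g = refl
  ∑-cong (i ∷ is) f≡g = cong₂ _+_ (f≡g i) (∑-cong is f≡g)

  ∑-mono : (is : List I) {f g : I → C} → (∀ i → f i ≤ g i) → ∑ is f ≤ ∑ is g
  ∑-mono []       f≤g = ≤-refl
  ∑-mono (i ∷ is) f≤g = +-mono-≤ (f≤g i) (∑-mono is f≤g)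

  ∑-zero : (is : List I) → ∑ is (λ _ → 0#) ≡ 0#
  ∑-zero []       = refl
  ∑-zero (i ∷ is) = trans (+-identityˡ _) (∑-zero is)

  ∑-nonneg : (is : List I) {f : I → C} → (∀ i → 0# ≤ f i) → 0# ≤ ∑ is f
  ∑-nonneg is {f} 0≤f = subst (_≤ ∑ is f) (∑-zero is) (∑-mono is 0≤f)

  interchange : ∀ a b c d → (a + b) + (c + d) ≡ (a + c) + (b + d)
  interchange a b c d =
    trans (+-assoc a b (c + d))
      (trans (cong (a +_) (trans (sym (+-assoc b c d)) (trans (cong (_+ d) (+-comm b c)) (+-assoc c b d))))
        (sym (+-assoc a c (b + d))))

  ∑-+ : (is : List I) (f g : I → C) → ∑ is (λ i → f i + g i) ≡ ∑ is f + ∑ is g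
  ∑-+ []       f g = sym (+-identityˡ 0#)
  ∑-+ (i ∷ is) f g = trans (cong ((f i + g i) +_) (∑-+ is f g)) (interchange _ _ _ _)

  ∑-*ˡ : (is : List I) (c : C) (f : I → C) → ∑ is (λ i → c * f i) ≡ c * ∑ is f
  ∑-*ˡ []       c f = sym (zeroʳ c)
  ∑-*ˡ (i ∷ is) c f = trans (cong (_ +_) (∑-*ˡ is c f)) (sym (distribˡ c _ _))

  ∑-*ʳ : (is : List I) (f : I → C) (c : C) → ∑ is (λ i → f i * c) ≡ ∑ is f * c
  ∑-*ʳ is f c = trans (∑-cong is (λ i → *-comm (f i) c)) (trans (∑-*ˡ is c f) (*-comm c _))

  ∑-if : (is : List I) (e : Bool) (f : I → C) → ∑ is (λ i → if e then f i else 0#) ≡ (if e then ∑ is f else 0#)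
  ∑-if is true  f = refl
  ∑-if is false f = ∑-zero is

  ∑-swap : (is : List I) (js : List J) (f : I → J → C) →
    ∑ is (λ i → ∑ js (f i)) ≡ ∑ js (λ j → ∑ is (λ i → f i j))
  ∑-swap []       js f = sym (∑-zero js)
  ∑-swap (i ∷ is) js f = trans (cong (_ +_) (∑-swap is js f)) (sym (∑-+ js _ _))

  ∑-++ : (is js : List I) (f : I → C) → ∑ (is ++ js) f ≡ ∑ is f + ∑ js f
  ∑-++ []       js f = sym (+-identityˡ _)
  ∑-++ (i ∷ is) js f = trans (cong (f i +_) (∑-++ is js f)) (sym (+-assoc _ _ _))

  ∑-map : (g : I → J) (is : List I) (f : J → C) → ∑ (List.map g is) f ≡ ∑ is (f ∘ g)
  ∑-map g []       f = refl
  ∑-map g (i ∷ is) f = cong (_ +_) (∑-map g is f)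

  ∑-allFin-suc : ∀ k (f : Fin (suc k) → C) → ∑ (allFin (suc k)) f ≡ f zero + ∑ (allFin k) (f ∘ suc)
  ∑-allFin-suc k f = cong (λ fs → f zero + foldr _+_ 0# fs)
    (trans (map-tabulate suc f) (sym (map-tabulate id (f ∘ suc))))

  ∑-allFin-point : ∀ {k} (i : Fin k) (f : Fin k → C) →
    ∑ (allFin k) (λ j → if i == j then f j else 0#) ≡ f i
  ∑-allFin-point {suc k} zero f =
    trans (∑-allFin-suc k (λ j → if zero == j then f j else 0#)) (trans (cong (f zero +_) (∑-zero (allFin k))) (+-identityʳ _))
  ∑-allFin-point {suc k} (suc i) f =
    trans (∑-allFin-suc k (λ j → if suc i == j then f j else 0#)) (trans (+-identityˡ _) (∑-allFin-point i (f ∘ suc)))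

  term≤∑ : ∀ {k} {f : Fin k → C} → (∀ i → 0# ≤ f i) → ∀ i → f i ≤ ∑ (allFin k) f
  term≤∑ {k} {f} 0≤f i = subst (_≤ ∑ (allFin k) f) (∑-allFin-point i f) (∑-mono (allFin k) (λ j → bound (i == j) j))
    where
    bound : ∀ e j → (if e then f j else 0#) ≤ f j
    bound true  j = ≤-refl
    bound false j = 0≤f j

  ∑-allSubsets-suc : ∀ k (f : Subset (suc k) → C) →
    ∑ (allSubsets (suc k)) f ≡ ∑ (allSubsets k) (λ X → f (true ∷ X)) + ∑ (allSubsets k) (λ X → f (false ∷ X))
  ∑-allSubsets-suc k f =
    trans (∑-++ (List.map (true ∷_) (allSubsets k)) _ f)
      (cong₂ _+_ (∑-map (true ∷_) (allSubsets k) f) (∑-map (false ∷_) (allSubsets k) f))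

  -- The Kronecker delta of two subsets, by recursion on bits so that it follows the splitting of
  -- `allSubsets`. It later serves as the unit weight on a single row.
  indicator : ∀ {k} → Subset k → Subset k → C
  indicator []          []          = 1#
  indicator (true  ∷ X) (true  ∷ Y) = indicator X Y
  indicator (true  ∷ X) (false ∷ Y) = 0#
  indicator (false ∷ X) (true  ∷ Y) = 0#
  indicator (false ∷ X) (false ∷ Y) = indicator X Y

  indicator-nonneg : 0# ≤ 1# → ∀ {k} (X Y : Subset k) → 0# ≤ indicator X Y
  indicator-nonneg 0≤1 []          []          = 0≤1
  indicator-nonneg 0≤1 (true  ∷ X) (true  ∷ Y) = indicator-nonneg 0≤1 X Y
  indicator-nonneg 0≤1 (true  ∷ X) (false ∷ Y) = ≤-refl
  indicator-nonneg 0≤1 (false ∷ X) (true  ∷ Y) = ≤-refl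
  indicator-nonneg 0≤1 (false ∷ X) (false ∷ Y) = indicator-nonneg 0≤1 X Y

  ∑-allSubsets-point : ∀ {k} (X : Subset k) (f : Subset k → C) →
    ∑ (allSubsets k) (λ Y → indicator X Y * f Y) ≡ f X
  ∑-allSubsets-point [] f = trans (+-identityʳ _) (*-identityˡ _)
  ∑-allSubsets-point {suc k} (true ∷ X) f =
    trans (∑-allSubsets-suc k _)
      (trans (cong₂ _+_ (∑-allSubsets-point X (f ∘ (true ∷_)))
        (trans (∑-cong (allSubsets k) (λ _ → zeroˡ _)) (∑-zero (allSubsets k)))) (+-identityʳ _))
  ∑-allSubsets-point {suc k} (false ∷ X) f =
    trans (∑-allSubsets-suc k _)
      (trans (cong₂ _+_ (trans (∑-cong (allSubsets k) (λ _ → zeroˡ _)) (∑-zero (allSubsets k)))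
        (∑-allSubsets-point X (f ∘ (false ∷_)))) (+-identityˡ _))

module ∑ℤ = FiniteSums ℤ._+_ ℤ._*_ (λ i → ℤ.- i) 0ℤ 1ℤ ℤ.+-*-isCommutativeRing ℤ._≤_ ℤ.≤-refl ℤ.+-mono-≤
module ∑ℚ = FiniteSums ℚ._+_ ℚ._*_ (λ p → ℚ.- p) 0ℚ 1ℚ ℚ.+-*-isCommutativeRing ℚ._≤_ ℚ.≤-refl ℚ.+-mono-≤

-- Fourier-Motzkin elimination and the Farkas alternative

module Farkas where
  open import Data.Rational using (_+_; _*_; -_; _-_; _≤_; _<_; 1/_; _⊔_; _⊓_)
  open import Data.Rational.Solver
  open +-*-Solver using (solve; _:+_; _:*_; :-_; _:-_; _:=_; con)

  dot : ∀ {k} → Vec ℚ k → Vec ℚ k → ℚ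
  dot []       []       = 0ℚ
  dot (a ∷ as) (x ∷ xs) = a * x + dot as xs

  Constraint : ℕ → Set
  Constraint k = Vec ℚ k × ℚ

  Satisfies : ∀ {k} → Vec ℚ k → Constraint k → Set
  Satisfies x (a , b) = b ≤ dot a x

  infixl 6 _⊕_
  infixr 7 _⊙_
  infixr 6 _◂_

  _⊕_ : ∀ {k} → Constraint k → Constraint k → Constraint k
  (a , b) ⊕ (a′ , b′) = Vec.zipWith _+_ a a′ , b + b′

  _⊙_ : ∀ {k} → ℚ → Constraint k → Constraint k
  t ⊙ (a , b) = Vec.map (t *_) a , t * b

  _◂_ : ∀ {k} → ℚ → Constraint k → Constraint (suc k)
  a₀ ◂ (a , b) = a₀ ∷ a , b

  dot-⊕ : ∀ {k} (a a′ x : Vec ℚ k) → dot (Vec.zipWith _+_ a a′) x ≡ dot a x + dot a′ x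
  dot-⊕ []      []        []      = refl
  dot-⊕ (a ∷ as) (b ∷ bs) (x ∷ xs) rewrite dot-⊕ as bs xs =
    solve 5 (λ a b x p q → (a :+ b) :* x :+ (p :+ q) := a :* x :+ p :+ (b :* x :+ q)) refl a b x (dot as xs) (dot bs xs)

  dot-⊙ : ∀ {k} t (a x : Vec ℚ k) → dot (Vec.map (t *_) a) x ≡ t * dot a x
  dot-⊙ t []       []       = sym (ℚ.*-zeroʳ t)
  dot-⊙ t (a ∷ as) (x ∷ xs) rewrite dot-⊙ t as xs =
    solve 4 (λ t a x p → t :* a :* x :+ t :* p := t :* (a :* x :+ p)) refl t a x (dot as xs)

  -- Derivations rather than coefficient vectors: elimination then only has to transport
  -- derivations, and the multipliers are read off once, at the end.
  data Cone {k} (cs : List (Constraint k)) : Constraint k → Set where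
    gen   : ∀ {c} → c ∈ cs → Cone cs c
    add   : ∀ {c d} → Cone cs c → Cone cs d → Cone cs (c ⊕ d)
    scale : ∀ {t c} → 0ℚ ≤ t → Cone cs c → Cone cs (t ⊙ c)

  weaken : ∀ {k} {cs : List (Constraint k)} {c d} → Cone cs d → Cone (c ∷ cs) d
  weaken (gen d∈)    = gen (there d∈)
  weaken (add p q)   = add (weaken p) (weaken q)
  weaken (scale t p) = scale t (weaken p)

  unscale : ∀ {k} (x : Vec ℚ k) t .{{_ : ℚ.Positive t}} c → Satisfies x (t ⊙ c) → Satisfies x c
  unscale x t (a , b) sat = ℚ.*-cancelˡ-≤-pos t (subst (t * b ≤_) (dot-⊙ t a x) sat)

  -- Scaling the coefficient of the first variable to 1, -1 or 0 sorts the constraints into lower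
  -- bounds, upper bounds and constraints free of that variable. The `Cone` fields carry refutations
  -- back to `cs`, and `sound` carries solutions back.
  record Normalised {k} (cs : List (Constraint (suc k))) : Set where
    field
      lowers uppers zeros : List (Constraint k)
      lower∈Cone : ∀ {c} → c ∈ lowers → Cone cs (1ℚ ◂ c)
      upper∈Cone : ∀ {c} → c ∈ uppers → Cone cs (- 1ℚ ◂ c)
      zero∈Cone  : ∀ {c} → c ∈ zeros → Cone cs (0ℚ ◂ c)
      sound : ∀ {x} →
        (∀ {c} → c ∈ lowers → Satisfies x (1ℚ ◂ c)) →
        (∀ {c} → c ∈ uppers → Satisfies x (- 1ℚ ◂ c)) →
        (∀ {c} → c ∈ zeros → Satisfies x (0ℚ ◂ c)) →
        ∀ {c} → c ∈ cs → Satisfies x c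

  scaledTo : ∀ {k} {cs : List (Constraint (suc k))} t {s a₀} c → 0ℚ ≤ t → t * a₀ ≡ s →
    Cone (a₀ ◂ c ∷ cs) (s ◂ t ⊙ c)
  scaledTo t c 0≤t refl = scale 0≤t (gen (here refl))

  unscaledFrom : ∀ {k} (x : Vec ℚ (suc k)) t .{{_ : ℚ.Positive t}} {s a₀} c → t * a₀ ≡ s →
    Satisfies x (s ◂ t ⊙ c) → Satisfies x (a₀ ◂ c)
  unscaledFrom x t c refl = unscale x t (_ ◂ c)

  normalise : ∀ {k} (cs : List (Constraint (suc k))) → Normalised cs
  normalise [] = record
    { lowers = [] ; uppers = [] ; zeros = []
    ; lower∈Cone = λ () ; upper∈Cone = λ () ; zero∈Cone = λ () ; sound = λ _ _ _ () }
  normalise ((a₀ ∷ a , b) ∷ cs) with normalise cs | ℚ.<-cmp a₀ 0ℚ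
  ... | N | tri< a₀<0 _ _ = record
    { lowers = lowers ; zeros = zeros
    ; uppers = t ⊙ (a , b) ∷ uppers
    ; lower∈Cone = weaken ∘ lower∈Cone
    ; upper∈Cone = λ { (here refl) → scaledTo t (a , b) (ℚ.<⇒≤ (ℚ.positive⁻¹ t)) ta₀≡-1
                     ; (there c∈) → weaken (upper∈Cone c∈) }
    ; zero∈Cone = weaken ∘ zero∈Cone
    ; sound = λ {x} L U Z → λ { (here refl) → unscaledFrom x t (a , b) ta₀≡-1 (U (here refl))
                                ; (there c∈) → sound L (U ∘ there) Z c∈ } }
    where
    open Normalised N
    instance
      -a₀>0 : ℚ.Positive (- a₀)
      -a₀>0 = ℚ.positive (ℚ.neg-antimono-< a₀<0)
      -a₀≢0 : ℚ.NonZero (- a₀)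
      -a₀≢0 = ℚ.pos⇒nonZero (- a₀)
    t : ℚ
    t = 1/ (- a₀)
    instance
      t>0 : ℚ.Positive t
      t>0 = ℚ.1/pos⇒pos (- a₀)
    ta₀≡-1 : t * a₀ ≡ - 1ℚ
    ta₀≡-1 = trans (solve 2 (λ t a → t :* a := :- (t :* (:- a))) refl t a₀) (cong -_ (ℚ.*-inverseˡ (- a₀)))
  ... | N | tri≈ _ refl _ = record
    { lowers = lowers ; uppers = uppers
    ; zeros = (a , b) ∷ zeros
    ; lower∈Cone = weaken ∘ lower∈Cone
    ; upper∈Cone = weaken ∘ upper∈Cone
    ; zero∈Cone = λ { (here refl) → gen (here refl) ; (there c∈) → weaken (zero∈Cone c∈) }
    ; sound = λ {x} L U Z → λ { (here refl) → Z (here refl) ; (there c∈) → sound L U (Z ∘ there) c∈ } }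
    where open Normalised N
  ... | N | tri> _ _ a₀>0 = record
    { uppers = uppers ; zeros = zeros
    ; lowers = t ⊙ (a , b) ∷ lowers
    ; lower∈Cone = λ { (here refl) → scaledTo t (a , b) (ℚ.<⇒≤ (ℚ.positive⁻¹ t)) (ℚ.*-inverseˡ a₀)
                     ; (there c∈) → weaken (lower∈Cone c∈) }
    ; upper∈Cone = weaken ∘ upper∈Cone
    ; zero∈Cone = weaken ∘ zero∈Cone
    ; sound = λ {x} L U Z → λ { (here refl) → unscaledFrom x t (a , b) (ℚ.*-inverseˡ a₀) (L (here refl))
                                ; (there c∈) → sound (L ∘ there) U Z c∈ } }
    where
    open Normalised N
    instance
      a₀-pos : ℚ.Positive a₀
      a₀-pos = ℚ.positive a₀>0
      a₀≢0 : ℚ.NonZero a₀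
      a₀≢0 = ℚ.pos⇒nonZero a₀
    t : ℚ
    t = 1/ a₀
    instance
      t>0 : ℚ.Positive t
      t>0 = ℚ.1/pos⇒pos a₀

  -- The value starts at an arbitrary 0, is lowered to meet every `U`, and is then raised to meet
  -- every `L`; by hypothesis the raising never passes a `U`.
  separate : {A : Set} (L U : A → ℚ) (ls us : List A) →
    (∀ {l u} → l ∈ ls → u ∈ us → L l ≤ U u) →
    ∃[ ξ ] (∀ {l} → l ∈ ls → L l ≤ ξ) × (∀ {u} → u ∈ us → ξ ≤ U u)
  separate L U [] [] L≤U = 0ℚ , (λ ()) , λ ()
  separate L U [] (u ∷ us) L≤U with separate L U [] us (λ ())
  ... | ξ , _ , ξ≤U = ξ ⊓ U u , (λ ()) ,
    λ { (here refl) → ℚ.p⊓q≤q ξ (U u) ; (there u∈) → ℚ.≤-trans (ℚ.p⊓q≤p ξ (U u)) (ξ≤U u∈) }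
  separate L U (l ∷ ls) us L≤U with separate L U ls us (L≤U ∘ there)
  ... | ξ , L≤ξ , ξ≤U = ξ ⊔ L l ,
    (λ { (here refl) → ℚ.p≤q⊔p ξ (L l) ; (there l∈) → ℚ.≤-trans (L≤ξ l∈) (ℚ.p≤p⊔q ξ (L l)) }) ,
    λ u∈ → ℚ.⊔-lub (ξ≤U u∈) (L≤U (here refl) u∈)

  Refuted : ∀ {k} → List (Constraint k) → Set
  Refuted {k} cs = ∃[ b ] 0ℚ < b × Cone cs (Vec.replicate k 0ℚ , b)

  -- Fourier–Motzkin elimination of the first variable.
  farkas : ∀ {k} (cs : List (Constraint k)) → (∃[ x ] ∀ {c} → c ∈ cs → Satisfies x c) ⊎ Refuted cs
  farkas {zero} [] = inj₁ ([] , λ ())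
  farkas {zero} (([] , b) ∷ cs) with b ℚ.≤? 0ℚ | farkas cs
  ... | no b≰0 | _ = inj₂ (b , ℚ.≰⇒> b≰0 , gen (here refl))
  ... | yes b≤0 | inj₁ ([] , sat) = inj₁ ([] , λ { (here refl) → b≤0 ; (there c∈) → sat c∈ })
  ... | yes b≤0 | inj₂ (b′ , b′>0 , p) = inj₂ (b′ , b′>0 , weaken p)
  farkas {suc k} cs
    with farkas (Normalised.zeros (normalise cs) ++
      cartesianProductWith _⊕_ (Normalised.lowers (normalise cs)) (Normalised.uppers (normalise cs)))
  ... | inj₂ (b , b>0 , p) = inj₂ (b , b>0 , lift p)
    where
    open Normalised (normalise cs)
    lift : ∀ {c} → Cone (zeros ++ cartesianProductWith _⊕_ lowers uppers) c → Cone cs (0ℚ ◂ c)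
    lift (gen c∈) with ∈-++⁻ zeros c∈
    ... | inj₁ c∈zeros = zero∈Cone c∈zeros
    ... | inj₂ c∈pairs with ∈-cartesianProductWith⁻ _⊕_ lowers uppers c∈pairs
    -- The leading coefficient 1 + (-1) evaluates to 0, so the sum is already free of the first
    -- variable.
    ...   | _ , _ , l∈ , u∈ , refl = add (lower∈Cone l∈) (upper∈Cone u∈)
    lift (add p q) = add (lift p) (lift q)
    lift (scale {t} {c} 0≤t p) = subst (λ s → Cone cs (s ◂ t ⊙ c)) (ℚ.*-zeroʳ t) (scale 0≤t (lift p))
  ... | inj₁ (x , sat) = inj₁ (ξ ∷ x , sound below above level)
    where
    open Normalised (normalise cs)
    L U : Constraint k → ℚ
    L (a , b) = b - dot a x
    U (a , b) = dot a x - b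
    -- That `x` satisfies the eliminated pair `l ⊕ u` says precisely that the lower bound from `l`
    -- lies below the upper bound from `u`.
    L≤U : ∀ {l u} → l ∈ lowers → u ∈ uppers → L l ≤ U u
    L≤U {a , b} {d , e} l∈ u∈ = subst₂ _≤_
      (solve 4 (λ p q b e → b :+ e :+ (:- p :- e) := b :- p) refl (dot a x) (dot d x) b e)
      (solve 4 (λ p q b e → p :+ q :+ (:- p :- e) := q :- e) refl (dot a x) (dot d x) b e)
      (ℚ.+-monoˡ-≤ (- dot a x - e)
        (subst (b + e ≤_) (dot-⊕ a d x) (sat (∈-++⁺ʳ zeros (∈-cartesianProductWith⁺ _⊕_ l∈ u∈)))))
    between : ∃[ ξ ] (∀ {l} → l ∈ lowers → L l ≤ ξ) × (∀ {u} → u ∈ uppers → ξ ≤ U u)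
    between = separate L U lowers uppers L≤U
    ξ : ℚ
    ξ = proj₁ between
    below : ∀ {c} → c ∈ lowers → Satisfies (ξ ∷ x) (1ℚ ◂ c)
    below {a , b} c∈ = subst₂ _≤_
      (solve 2 (λ p b → b :- p :+ p := b) refl (dot a x) b)
      (solve 2 (λ ξ p → ξ :+ p := con 1ℚ :* ξ :+ p) refl ξ (dot a x))
      (ℚ.+-monoˡ-≤ (dot a x) (proj₁ (proj₂ between) c∈))
    above : ∀ {c} → c ∈ uppers → Satisfies (ξ ∷ x) (- 1ℚ ◂ c)
    above {a , b} c∈ = subst₂ _≤_
      (solve 2 (λ ξ b → ξ :+ (b :- ξ) := b) refl ξ b)
      (solve 3 (λ ξ p b → p :- b :+ (b :- ξ) := con (- 1ℚ) :* ξ :+ p) refl ξ (dot a x) b)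
      (ℚ.+-monoˡ-≤ (b - ξ) (proj₂ (proj₂ between) c∈))
    level : ∀ {c} → c ∈ zeros → Satisfies (ξ ∷ x) (0ℚ ◂ c)
    level {a , b} c∈ = subst (b ≤_)
      (solve 2 (λ ξ p → p := con 0ℚ :* ξ :+ p) refl ξ (dot a x)) (sat (∈-++⁺ˡ c∈))

∈-allSubsets : ∀ {k} (X : Subset k) → X ∈ allSubsets k
∈-allSubsets []          = here refl
∈-allSubsets (true  ∷ X) = ∈-++⁺ˡ (∈-map⁺ _ (∈-allSubsets X))
∈-allSubsets {suc k} (false ∷ X) = ∈-++⁺ʳ (List.map (true ∷_) (allSubsets k)) (∈-map⁺ _ (∈-allSubsets X))

-- The program min c·x subject to A x ≥ b, x ≥ 0, with a target value `δ`

module LinearProgram {k m} (A : Subset k → Fin m → ℚ) (b : Subset k → ℚ) (c : Fin m → ℚ) (δ : ℚ) where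
  open import Data.Rational using (_+_; _*_; -_; _≤_; _<_)
  open import Data.Rational.Solver
  open +-*-Solver using (solve; _:+_; _:*_; :-_; _:=_; con)
  open Farkas
  open ∑ℚ

  *-nonneg : ∀ {p q} → 0ℚ ≤ p → 0ℚ ≤ q → 0ℚ ≤ p * q
  *-nonneg {p} {q} 0≤p 0≤q = ℚ.nonNegative⁻¹ (p * q) {{ℚ.nonNeg*nonNeg⇒nonNeg p {{ℚ.nonNegative 0≤p}} q {{ℚ.nonNegative 0≤q}}}}

  *-monoˡ : ∀ {p q r} → 0ℚ ≤ r → p ≤ q → r * p ≤ r * q
  *-monoˡ {r = r} 0≤r p≤q = ℚ.*-monoˡ-≤-nonNeg r {{ℚ.nonNegative 0≤r}} p≤q

  dot-tabulate : ∀ {j} (f : Fin j → ℚ) (x : Vec ℚ j) →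
    dot (tabulate f) x ≡ ∑ (allFin j) (λ a → f a * lookup x a)
  dot-tabulate f [] = refl
  dot-tabulate {suc j} f (x₀ ∷ x) =
    trans (cong (f zero * x₀ +_) (dot-tabulate (f ∘ suc) x))
      (sym (∑-allFin-suc j (λ a → f a * lookup (x₀ ∷ x) a)))

  unit : Fin m → Fin m → ℚ
  unit a j = if a == j then 1ℚ else 0ℚ

  dot-unit : ∀ a x → dot (tabulate (unit a)) x ≡ lookup x a
  dot-unit a x = trans (dot-tabulate (unit a) x)
    (trans (∑-cong (allFin m) (λ j → select (a == j) (lookup x j))) (∑-allFin-point a (lookup x)))
    where
    select : ∀ e q → (if e then 1ℚ else 0ℚ) * q ≡ (if e then q else 0ℚ)
    select true  q = ℚ.*-identityˡ q
    select false q = ℚ.*-zeroˡ q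

  ∑A : (Subset k → ℚ) → Fin m → ℚ
  ∑A u a = ∑ (allSubsets k) (λ i → u i * A i a)

  ∑b : (Subset k → ℚ) → ℚ
  ∑b u = ∑ (allSubsets k) (λ i → u i * b i)

  rowConstraint : Subset k → Constraint m
  rowConstraint i = tabulate (A i) , b i

  signConstraint : Fin m → Constraint m
  signConstraint a = tabulate (unit a) , 0ℚ

  costConstraint : Constraint m
  costConstraint = tabulate (λ a → - c a) , - δ

  system : List (Constraint m)
  system = costConstraint ∷ List.map rowConstraint (allSubsets k) ++ List.map signConstraint (allFin m)

  -- A combination of the rows (weights u), the cost constraint (weight t) and sign constraints,
  -- whose weights are left implicit in the inequality of packs.
  record Multipliers (con : Constraint m) : Set where
    constructor multipliers
    field
      u      : Subset k → ℚ
      t      : ℚ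
      0≤u    : ∀ i → 0ℚ ≤ u i
      0≤t    : 0ℚ ≤ t
      packs  : ∀ a → ∑A u a ≤ lookup (proj₁ con) a + t * c a
      value  : proj₂ con + t * δ ≤ ∑b u

  ∑-zero* : (f : Subset k → ℚ) → ∑ (allSubsets k) (λ i → 0ℚ * f i) ≡ 0ℚ
  ∑-zero* f = trans (∑-cong (allSubsets k) (λ i → ℚ.*-zeroˡ (f i))) (∑-zero (allSubsets k))

  ∑-+* : (u v f : Subset k → ℚ) →
    ∑ (allSubsets k) (λ i → (u i + v i) * f i) ≡ ∑ (allSubsets k) (λ i → u i * f i) + ∑ (allSubsets k) (λ i → v i * f i)
  ∑-+* u v f = trans (∑-cong (allSubsets k) (λ i → ℚ.*-distribʳ-+ (f i) (u i) (v i))) (∑-+ (allSubsets k) _ _)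

  ∑-** : ∀ s (u f : Subset k → ℚ) →
    ∑ (allSubsets k) (λ i → (s * u i) * f i) ≡ s * ∑ (allSubsets k) (λ i → u i * f i)
  ∑-** s u f = trans (∑-cong (allSubsets k) (λ i → ℚ.*-assoc s (u i) (f i))) (∑-*ˡ (allSubsets k) s _)

  generator : ∀ {con} → con ∈ system → Multipliers con
  generator (here refl) = multipliers (λ _ → 0ℚ) 1ℚ (λ _ → ℚ.≤-refl) (ℚ.<⇒≤ (ℚ.positive⁻¹ 1ℚ))
    (λ a → ℚ.≤-reflexive (trans (∑-zero* (λ i → A i a))
      (trans (solve 1 (λ c → con 0ℚ := :- c :+ con 1ℚ :* c) refl (c a))
        (cong (_+ 1ℚ * c a) (sym (lookup∘tabulate (λ a → - c a) a))))))
    (ℚ.≤-reflexive (trans (solve 1 (λ δ → :- δ :+ con 1ℚ :* δ := con 0ℚ) refl δ) (sym (∑-zero* b))))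
  generator (there con∈) with ∈-++⁻ (List.map rowConstraint (allSubsets k)) con∈
  generator (there con∈) | inj₁ row∈ with ∈-map⁻ rowConstraint row∈
  ... | i , _ , refl = multipliers (indicator i) 0ℚ (indicator-nonneg (ℚ.<⇒≤ (ℚ.positive⁻¹ 1ℚ)) i) ℚ.≤-refl
    (λ a → ℚ.≤-reflexive (trans (∑-allSubsets-point i (λ j → A j a))
      (trans (solve 2 (λ p c → p := p :+ con 0ℚ :* c) refl (A i a) (c a))
        (cong (_+ 0ℚ * c a) (sym (lookup∘tabulate (A i) a))))))
    (ℚ.≤-reflexive (trans (solve 2 (λ p δ → p :+ con 0ℚ :* δ := p) refl (b i) δ) (sym (∑-allSubsets-point i b))))
  generator (there con∈) | inj₂ sign∈ with ∈-map⁻ signConstraint sign∈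
  ... | a , _ , refl = multipliers (λ _ → 0ℚ) 0ℚ (λ _ → ℚ.≤-refl) ℚ.≤-refl
    (λ j → subst₂ _≤_ (sym (∑-zero* (λ i → A i j)))
      (trans (solve 2 (λ p c → p := p :+ con 0ℚ :* c) refl (unit a j) (c j))
        (cong (_+ 0ℚ * c j) (sym (lookup∘tabulate (unit a) j))))
      (nonneg (a == j)))
    (ℚ.≤-reflexive (trans (solve 1 (λ δ → con 0ℚ :+ con 0ℚ :* δ := con 0ℚ) refl δ) (sym (∑-zero* b))))
    where
    nonneg : ∀ e → 0ℚ ≤ (if e then 1ℚ else 0ℚ)
    nonneg true  = ℚ.<⇒≤ (ℚ.positive⁻¹ 1ℚ)
    nonneg false = ℚ.≤-refl

  combine : ∀ {con} → Cone system con → Multipliers con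
  combine (gen con∈) = generator con∈
  combine (add {α , β} {α′ , β′} p q) with combine p | combine q
  ... | multipliers u t 0≤u 0≤t packs value | multipliers u′ t′ 0≤u′ 0≤t′ packs′ value′ =
    multipliers (λ i → u i + u′ i) (t + t′) (λ i → ℚ.+-mono-≤ (0≤u i) (0≤u′ i)) (ℚ.+-mono-≤ 0≤t 0≤t′)
      (λ a → subst₂ _≤_ (sym (∑-+* u u′ (λ i → A i a)))
        (trans (solve 5 (λ p q t t′ c → p :+ t :* c :+ (q :+ t′ :* c) := p :+ q :+ (t :+ t′) :* c) refl
            (lookup α a) (lookup α′ a) t t′ (c a))
          (cong (_+ (t + t′) * c a) (sym (lookup-zipWith _+_ a α α′))))
        (ℚ.+-mono-≤ (packs a) (packs′ a)))
      (subst₂ _≤_ (solve 5 (λ p q t t′ c → p :+ t :* c :+ (q :+ t′ :* c) := p :+ q :+ (t :+ t′) :* c) refl β β′ t t′ δ)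
        (sym (∑-+* u u′ b)) (ℚ.+-mono-≤ value value′))
  combine (scale {s} {α , β} 0≤s p) with combine p
  ... | multipliers u t 0≤u 0≤t packs value =
    multipliers (λ i → s * u i) (s * t) (λ i → *-nonneg 0≤s (0≤u i)) (*-nonneg 0≤s 0≤t)
      (λ a → subst₂ _≤_ (sym (∑-** s u (λ i → A i a)))
        (trans (solve 4 (λ s p t c → s :* (p :+ t :* c) := s :* p :+ s :* t :* c) refl s (lookup α a) t (c a))
          (cong (_+ s * t * c a) (sym (lookup-map a (s *_) α))))
        (*-monoˡ 0≤s (packs a)))
      (subst₂ _≤_ (solve 4 (λ s p t c → s :* (p :+ t :* c) := s :* p :+ s :* t :* c) refl s β t δ)
        (sym (∑-** s u b)) (*-monoˡ 0≤s value))

  -- A refutation of `system` amounts to weights with uA ≤ tc and ub > tδ, which the hypothesis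
  -- forbids. The case t = 0 is a certificate that A x ≥ b, x ≥ 0 has no solution at all.
  strongDuality :
    (∀ u t → (∀ i → 0ℚ ≤ u i) → 0ℚ ≤ t → (∀ a → ∑A u a ≤ t * c a) → ∑b u ≤ t * δ) →
    ∃[ x ] (∀ a → 0ℚ ≤ x a) × (∀ i → b i ≤ ∑ (allFin m) (λ a → A i a * x a)) ×
           ∑ (allFin m) (λ a → c a * x a) ≤ δ
  strongDuality bound with farkas system
  ... | inj₁ (x , sat) = lookup x
    , (λ a → subst (0ℚ ≤_) (dot-unit a x)
        (sat (there (∈-++⁺ʳ (List.map rowConstraint (allSubsets k)) (∈-map⁺ signConstraint (∈-allFin a))))))
    , (λ i → subst (b i ≤_) (dot-tabulate (A i) x)
        (sat (there (∈-++⁺ˡ (∈-map⁺ rowConstraint (∈-allSubsets i))))))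
    , subst₂ _≤_ (trans (cong -_ negated) (neg-involutive cost)) (neg-involutive δ)
        (ℚ.neg-antimono-≤ (sat (here refl)))
    where
    cost : ℚ
    cost = ∑ (allFin m) (λ a → c a * lookup x a)
    neg-involutive : ∀ p → - (- p) ≡ p
    neg-involutive = solve 1 (λ p → :- (:- p) := p) refl
    negated : dot (tabulate (λ a → - c a)) x ≡ - cost
    negated = trans (dot-tabulate (λ a → - c a) x)
      (trans (∑-cong (allFin m) (λ a → solve 2 (λ c x → :- c :* x := con (- 1ℚ) :* (c :* x)) refl (c a) (lookup x a)))
        (trans (∑-*ˡ (allFin m) (- 1ℚ) (λ a → c a * lookup x a))
          (solve 1 (λ p → con (- 1ℚ) :* p := :- p) refl cost)))
  ... | inj₂ (β , β>0 , p) with combine p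
  ...   | multipliers u t 0≤u 0≤t packs value = contradiction
    (ℚ.≤-trans value (bound u t 0≤u 0≤t
      (λ a → subst (∑A u a ≤_) (trans (cong (_+ t * c a) (lookup-replicate a 0ℚ)) (ℚ.+-identityˡ (t * c a))) (packs a))))
    (λ β+tδ≤tδ → ℚ.<-irrefl refl
      (ℚ.<-≤-trans (subst (_< β + t * δ) (ℚ.+-identityˡ (t * δ)) (ℚ.+-monoˡ-< (t * δ) β>0)) β+tδ≤tδ))

-- Passage between integers and rationals

-- Division in ℚ reduces by a gcd and does not compute on a variable numerator, so `toℚ` is handled
-- through unnormalised fractions. The second argument 0 of `mkℚᵘ` encodes the denominator 1.
toℚᵘ-toℚ : ∀ i → ℚ.toℚᵘ (toℚ i) ℚᵘ.≃ ℚᵘ.mkℚᵘ i 0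
toℚᵘ-toℚ i = ℚ.toℚᵘ-fromℚᵘ (ℚᵘ.mkℚᵘ i 0)

toℚ-+ : ∀ i j → toℚ (i ℤ.+ j) ≡ toℚ i ℚ.+ toℚ j
toℚ-+ i j = ℚ.toℚᵘ-injective (ℚᵘ.≃-trans (toℚᵘ-toℚ (i ℤ.+ j)) (ℚᵘ.≃-trans
  (ℚᵘ.≃-reflexive (cong (λ k → ℚᵘ.mkℚᵘ k 0) (sym (cong₂ ℤ._+_ (ℤ.*-identityʳ i) (ℤ.*-identityʳ j)))))
  (ℚᵘ.≃-sym (ℚᵘ.≃-trans (ℚ.toℚᵘ-homo-+ (toℚ i) (toℚ j)) (ℚᵘ.+-cong (toℚᵘ-toℚ i) (toℚᵘ-toℚ j))))))

toℚ-cancel-≤ : ∀ {i j} → toℚ i ℚ.≤ toℚ j → i ℤ.≤ j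
toℚ-cancel-≤ {i} {j} i≤j = subst₂ ℤ._≤_ (ℤ.*-identityʳ i) (ℤ.*-identityʳ j)
  (ℚᵘ.drop-*≤* (ℚᵘ.≤-respʳ-≃ (toℚᵘ-toℚ j) (ℚᵘ.≤-respˡ-≃ (toℚᵘ-toℚ i) (ℚ.toℚᵘ-mono-≤ i≤j))))

∑-toℚ : {I : Set} (is : List I) (P : I → Bool) (f : I → ℤ) →
  ∑ℚ.∑ is (λ i → if P i then toℚ (f i) else 0ℚ) ≡ toℚ (∑ℤ.∑ is (λ i → if P i then f i else 0ℤ))
∑-toℚ []       P f = refl
∑-toℚ (i ∷ is) P f = trans (cong₂ ℚ._+_ (branch (P i)) (∑-toℚ is P f)) (sym (toℚ-+ (if P i then f i else 0ℤ) _))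
  where
  branch : ∀ e → (if e then toℚ (f i) else 0ℚ) ≡ toℚ (if e then f i else 0ℤ)
  branch true  = refl
  branch false = refl

-- Strong duality for (P) and (D)

module _ (G : Net) where
  open import Data.Rational using (_+_; _*_; -_; _-_; _≤_; 1/_)
  open import Data.Rational.Solver
  open +-*-Solver using (solve; _:+_; _:*_; _:-_; _:=_; con)
  open ∑ℚ

  -- The rows of (P) are indexed by subsets of a set with one extra element: true ∷ X
  -- stands for X as a subset of S, false ∷ X for X as a subset of T.
  row : Subset (suc (n G)) → Bool
  row (true  ∷ X) = validS G X
  row (false ∷ X) = validT G X

  crosses : Subset (suc (n G)) → Fin (m G) → Bool
  crosses (true  ∷ X) a = outOf G X a
  crosses (false ∷ X) a = into G X a

  Σ-perturb : ∀ {k} (P : Subset k → Bool) s (u y : Subset k → ℚ) →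
    Σℚ⟦ P ∣ (λ X → s * (u X + y X)) ⟧ ≡ s * (∑ (allSubsets k) (λ X → u X * bℚ (P X)) + Σℚ⟦ P ∣ y ⟧)
  Σ-perturb {k} P s u y =
    trans (∑-cong (allSubsets k) (λ X → branch (P X) (u X) (y X)))
      (trans (∑-*ˡ (allSubsets k) s _) (cong (s *_) (∑-+ (allSubsets k) _ _)))
    where
    branch : ∀ e p q → (if e then s * (p + q) else 0ℚ) ≡ s * (p * bℚ e + (if e then q else 0ℚ))
    branch true  p q = solve 3 (λ s p q → s :* (p :+ q) := s :* (p :* con 1ℚ :+ q)) refl s p q
    branch false p q = solve 2 (λ s p → con 0ℚ := s :* (p :* con 0ℚ :+ con 0ℚ)) refl s p

  reciprocal : ∀ {t} → 0ℚ ≤ t → ∃[ s ] 0ℚ ≤ s × (1ℚ + t) * s ≡ 1ℚ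
  reciprocal {t} 0≤t = 1/ (1ℚ + t) , ℚ.<⇒≤ (ℚ.positive⁻¹ (1/ (1ℚ + t)) {{ℚ.1/pos⇒pos (1ℚ + t)}}) , ℚ.*-inverseʳ (1ℚ + t)
    where
    instance
      1+t>0 : ℚ.Positive (1ℚ + t)
      1+t>0 = ℚ.pos+nonNeg⇒pos 1ℚ t {{ℚ.nonNegative 0≤t}}
      1+t≢0 : ℚ.NonZero (1ℚ + t)
      1+t≢0 = ℚ.pos⇒nonZero (1ℚ + t)

  regroup : ∀ s p q y z → s * (p + y) + s * (q + z) ≡ s * (p + q + (y + z))
  regroup = solve 5 (λ s p q y z → s :* (p :+ y) :+ s :* (q :+ z) := s :* (p :+ q :+ (y :+ z))) refl

  rescale : ∀ t s q → (1ℚ + t) * s ≡ 1ℚ → s * (t * q + q) ≡ q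
  rescale t s q rs≡1 = trans (solve 3 (λ t s q → s :* (t :* q :+ q) := (con 1ℚ :+ t) :* s :* q) refl t s q)
    (trans (cong (_* q) rs≡1) (ℚ.*-identityˡ q))

  -- Multiplying by 1 + t, the inverse of `s`, gives p + δ ≤ (1 + t)δ; then δ is subtracted.
  unscale-≤ : ∀ {t} s p δ → 0ℚ ≤ t → (1ℚ + t) * s ≡ 1ℚ → s * (p + δ) ≤ δ → p ≤ t * δ
  unscale-≤ {t} s p δ 0≤t rs≡1 s[p+δ]≤δ = subst₂ _≤_
    (trans (solve 4 (λ t s p δ → (con 1ℚ :+ t) :* (s :* (p :+ δ)) :- δ := (con 1ℚ :+ t) :* s :* (p :+ δ) :- δ) refl t s p δ)
      (trans (cong (λ e → e * (p + δ) - δ) rs≡1) (solve 2 (λ p δ → con 1ℚ :* (p :+ δ) :- δ := p) refl p δ)))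
    (solve 2 (λ t δ → (con 1ℚ :+ t) :* δ :- δ := t :* δ) refl t δ)
    (ℚ.+-monoˡ-≤ (- δ) (ℚ.*-monoˡ-≤-nonNeg (1ℚ + t) {{ℚ.nonNegative (ℚ.+-mono-≤ (ℚ.<⇒≤ (ℚ.positive⁻¹ 1ℚ)) 0≤t)}} s[p+δ]≤δ))

  -- A certificate (u , t) violating the bound would make (u + y) / (1 + t) a better dual solution.
  dualBound : ∀ y z → DOptimal G y z → ∀ (u : Subset (suc (n G)) → ℚ) t → (∀ i → 0ℚ ≤ u i) → 0ℚ ≤ t →
    (∀ a → ∑ (allSubsets _) (λ i → u i * bℚ (row i ∧ crosses i a)) ≤ t * toℚ (ℤ.+ w G a)) →
    ∑ (allSubsets _) (λ i → u i * bℚ (row i)) ≤ t * Dobj G y z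
  dualBound y z ((packs , 0≤y , 0≤z) , optimal) u t 0≤u 0≤t u-packs with reciprocal 0≤t
  ... | s , 0≤s , rs≡1 = unscale-≤ s ∑u (Dobj G y z) 0≤t rs≡1 (subst (_≤ Dobj G y z) objective (optimal y′ z′ feasible))
    where
    ∑u : ℚ
    ∑u = ∑ (allSubsets (suc (n G))) (λ i → u i * bℚ (row i))

    y′ z′ : Subset (n G) → ℚ
    y′ X = s * (u (true ∷ X) + y X)
    z′ X = s * (u (false ∷ X) + z X)

    s*-mono : ∀ {p q} → p ≤ q → s * p ≤ s * q
    s*-mono = ℚ.*-monoˡ-≤-nonNeg s {{ℚ.nonNegative 0≤s}}

    s*-nonneg : ∀ {p} → 0ℚ ≤ p → 0ℚ ≤ s * p
    s*-nonneg {p} 0≤p = subst (_≤ s * p) (ℚ.*-zeroʳ s) (s*-mono 0≤p)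

    perturbed : (P : Subset (suc (n G)) → Bool) →
      Σℚ⟦ (λ X → P (true ∷ X)) ∣ y′ ⟧ + Σℚ⟦ (λ X → P (false ∷ X)) ∣ z′ ⟧ ≡
      s * (∑ (allSubsets (suc (n G))) (λ i → u i * bℚ (P i)) + (Σℚ⟦ (λ X → P (true ∷ X)) ∣ y ⟧ + Σℚ⟦ (λ X → P (false ∷ X)) ∣ z ⟧))
    perturbed P =
      trans (cong₂ _+_ (Σ-perturb (P ∘ (true ∷_)) s (u ∘ (true ∷_)) y) (Σ-perturb (P ∘ (false ∷_)) s (u ∘ (false ∷_)) z))
        (trans (regroup s (part true) (part false) Σℚ⟦ P ∘ (true ∷_) ∣ y ⟧ Σℚ⟦ P ∘ (false ∷_) ∣ z ⟧)
          (cong (λ e → s * (e + (Σℚ⟦ P ∘ (true ∷_) ∣ y ⟧ + Σℚ⟦ P ∘ (false ∷_) ∣ z ⟧)))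
            (sym (∑-allSubsets-suc (n G) (λ i → u i * bℚ (P i))))))
      where
      part : Bool → ℚ
      part e = ∑ (allSubsets (n G)) (λ X → u (e ∷ X) * bℚ (P (e ∷ X)))

    objective : Dobj G y′ z′ ≡ s * (∑u + Dobj G y z)
    objective = perturbed row

    feasible : DFeasible G y′ z′
    feasible =
      -- At each arc the certificate uses at most t·w(a) and the old solution at most w(a), so
      -- division by 1 + t restores the capacity w(a).
      (λ a → subst₂ _≤_ (sym (perturbed (λ i → row i ∧ crosses i a))) (rescale t s (toℚ (ℤ.+ w G a)) rs≡1)
        (s*-mono (ℚ.+-mono-≤ (u-packs a) (packs a)))) ,
      (λ X v → s*-nonneg (ℚ.+-mono-≤ (0≤u (true ∷ X)) (0≤y X v))) ,
      (λ X v → s*-nonneg (ℚ.+-mono-≤ (0≤u (false ∷ X)) (0≤z X v)))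

  covered : ∀ (x : Fin (m G) → ℚ) e (P : Fin (m G) → Bool) →
    bℚ e ≤ ∑ (allFin (m G)) (λ a → bℚ (e ∧ P a) * x a) → e ≡ true → 1ℚ ≤ Σℚ[ P ∣ x ]
  covered x e P covers refl = subst (1ℚ ≤_) (∑-cong (allFin (m G)) (λ a → select (P a) (x a))) covers
    where
    select : ∀ e q → bℚ e * q ≡ (if e then q else 0ℚ)
    select true  q = ℚ.*-identityˡ q
    select false q = ℚ.*-zeroˡ q

  strongDuality : ∀ y z → DOptimal G y z → ∃[ x ] PFeasible G x × Pcost G x ≤ Dobj G y z
  strongDuality y z yz-optimal = x ,
    ((λ X → covered x (validS G X) (outOf G X) (covers (true ∷ X))) ,
     (λ X → covered x (validT G X) (into G X) (covers (false ∷ X))) , proj₁ (proj₂ solution)) ,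
    proj₂ (proj₂ (proj₂ solution))
    where
    solution : ∃[ x ] (∀ a → 0ℚ ≤ x a) ×
      (∀ i → bℚ (row i) ≤ ∑ (allFin (m G)) (λ a → bℚ (row i ∧ crosses i a) * x a)) ×
      ∑ (allFin (m G)) (λ a → toℚ (ℤ.+ w G a) * x a) ≤ Dobj G y z
    -- An index that stands for no constraint of (P) yields the trivial row 0 ≥ 0, so every subset
    -- can serve as an index.
    solution = LinearProgram.strongDuality (λ i a → bℚ (row i ∧ crosses i a)) (λ i → bℚ (row i))
           (λ a → toℚ (ℤ.+ w G a)) (Dobj G y z) (dualBound y z yz-optimal)
    x : Fin (m G) → ℚ
    x = proj₁ solution
    covers : ∀ i → bℚ (row i) ≤ ∑ (allFin (m G)) (λ a → bℚ (row i ∧ crosses i a) * x a)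
    covers = proj₁ (proj₂ (proj₂ solution))

  -- Optimality of `x` compares it with the rational solution supplied by `strongDuality`; both ends
  -- of the resulting chain are integers, so it descends to ℤ.
  integralDuality : ∀ x y z → POptimal G (λ a → bℚ (x a)) → DOptimal G (λ X → toℚ (y X)) (λ X → toℚ (z X)) →
    Σℤ[ x ∣ (λ a → ℤ.+ w G a) ] ℤ.≤ Σℤ⟦ validS G ∣ y ⟧ ℤ.+ Σℤ⟦ validT G ∣ z ⟧
  integralDuality x y z (_ , x-optimal) yz-optimal =
    toℚ-cancel-≤ (subst₂ _≤_ cost objective
      (ℚ.≤-trans (x-optimal x′ (proj₁ (proj₂ solution))) (proj₂ (proj₂ solution))))
    where
    solution : ∃[ x′ ] PFeasible G x′ × Pcost G x′ ≤ Dobj G (λ X → toℚ (y X)) (λ X → toℚ (z X))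
    solution = strongDuality (λ X → toℚ (y X)) (λ X → toℚ (z X)) yz-optimal
    x′ : Fin (m G) → ℚ
    x′ = proj₁ solution
    cost : Pcost G (λ a → bℚ (x a)) ≡ toℚ Σℤ[ x ∣ (λ a → ℤ.+ w G a) ]
    cost = trans (∑-cong (allFin (m G)) (λ a → select (x a) (toℚ (ℤ.+ w G a)))) (∑-toℚ (allFin (m G)) x (λ a → ℤ.+ w G a))
      where
      select : ∀ e q → q * bℚ e ≡ (if e then q else 0ℚ)
      select true  q = ℚ.*-identityʳ q
      select false q = ℚ.*-zeroʳ q
    objective : Dobj G (λ X → toℚ (y X)) (λ X → toℚ (z X)) ≡ toℚ (Σℤ⟦ validS G ∣ y ⟧ ℤ.+ Σℤ⟦ validT G ∣ z ⟧)
    objective = trans (cong₂ _+_ (∑-toℚ (allSubsets (n G)) (validS G) y) (∑-toℚ (allSubsets (n G)) (validT G) z))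
      (sym (toℚ-+ Σℤ⟦ validS G ∣ y ⟧ Σℤ⟦ validT G ∣ z ⟧))

-- Reflection of the Boolean encodings

true≢false : ∀ {e} → e ≡ true → e ≡ false → ⊥
true≢false refl ()

∧-elim : ∀ {d e} → d ∧ e ≡ true → d ≡ true × e ≡ true
∧-elim {true} {true} refl = refl , refl

not-false : ∀ {e} → e ≡ false → not e ≡ true
not-false refl = refl

not-true : ∀ {e} → not e ≡ true → e ≡ false
not-true {false} refl = refl

==-refl : ∀ {k} (i : Fin k) → (i == i) ≡ true
==-refl i with i ≟ i
... | yes _  = refl
... | no i≢i = contradiction refl i≢i

==-sound : ∀ {k} {i j : Fin k} → (i == j) ≡ true → i ≡ j
==-sound {i = i} {j} eq with i ≟ j
... | yes i≡j = i≡j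

anyᵇ⁺ : ∀ {A : Set} {P : A → Bool} {as a} → a ∈ as → P a ≡ true → anyᵇ P as ≡ true
anyᵇ⁺ (here refl) Pa rewrite Pa = refl
anyᵇ⁺ {P = P} {b ∷ _} (there a∈) Pa rewrite anyᵇ⁺ {P = P} a∈ Pa = Bool.∨-zeroʳ (P b)

anyᵇ⁻ : ∀ {A : Set} {P : A → Bool} as → anyᵇ P as ≡ true → ∃[ a ] P a ≡ true
anyᵇ⁻ {P = P} (a ∷ as) eq with P a in Pa
... | true  = a , Pa
... | false = anyᵇ⁻ as eq

allᵇ⁺ : ∀ {A : Set} {P : A → Bool} as → (∀ a → P a ≡ true) → allᵇ P as ≡ true
allᵇ⁺ []       P-all = refl
allᵇ⁺ (a ∷ as) P-all rewrite P-all a = allᵇ⁺ as P-all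

allᵇ⁻ : ∀ {A : Set} {P : A → Bool} {as a} → allᵇ P as ≡ true → a ∈ as → P a ≡ true
allᵇ⁻ eq (here refl) = proj₁ (∧-elim eq)
allᵇ⁻ {P = P} {b ∷ _} eq (there a∈) = allᵇ⁻ (proj₂ (∧-elim {P b} eq)) a∈

∣∣-remove : ∀ {k} (X : Subset k) v → lookup X v ≡ true → ∣ X [ v ]≔ false ∣ ℕ.< ∣ X ∣
∣∣-remove (true  ∷ X) zero    refl = ℕ.n<1+n ∣ X ∣
∣∣-remove (true  ∷ X) (suc v) v∈X  = ℕ.s<s (∣∣-remove X v v∈X)
∣∣-remove (false ∷ X) (suc v) v∈X  = ∣∣-remove X v v∈X

-- With (src , tgt) = (tl , hd) and U = T these are the branchings in D[T]; with
-- (src , tgt) = (hd , tl) and U = S they are the cobranchings in D[S].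
module Oriented (G : Net) (src tgt : Fin (m G) → Fin (n G)) (U : Fin (n G) → Bool) where

  valid : Subset (n G) → Bool
  valid X = anyᵇ (_∈ᵇ X) (allFin _) ∧ allᵇ (λ v → not (v ∈ᵇ X) ∨ U v) (allFin _)

  enters : Subset (n G) → Fin (m G) → Bool
  enters X a = not (src a ∈ᵇ X) ∧ (tgt a ∈ᵇ X)

  valid⁺ : ∀ X {v} → (v ∈ᵇ X) ≡ true → (∀ u → (u ∈ᵇ X) ≡ true → U u ≡ true) → valid X ≡ true
  valid⁺ X {v} v∈X X⊆U = cong₂ _∧_ (anyᵇ⁺ {P = _∈ᵇ X} (∈-allFin v) v∈X) (allᵇ⁺ (allFin _) inside)
    where
    inside : ∀ u → not (u ∈ᵇ X) ∨ U u ≡ true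
    inside u with u ∈ᵇ X in u∈X
    ... | true  = X⊆U u u∈X
    ... | false = refl

  valid⇒nonempty : ∀ X → valid X ≡ true → ∃[ v ] (v ∈ᵇ X) ≡ true
  valid⇒nonempty X X-valid = anyᵇ⁻ (allFin _) (proj₁ (∧-elim X-valid))

  valid⇒⊆ : ∀ X → valid X ≡ true → ∀ {v} → (v ∈ᵇ X) ≡ true → U v ≡ true
  valid⇒⊆ X X-valid {v} v∈X
    with allᵇ⁻ {P = λ u → not (u ∈ᵇ X) ∨ U u} (proj₂ (∧-elim {anyᵇ (_∈ᵇ X) (allFin _)} X-valid)) (∈-allFin v)
  ... | holds rewrite v∈X = holds

  -- If each vertex of `X` is entered by an arc of `B` from within `X`, arcs can be followed
  -- backwards forever; a vertex must then repeat, which closes a directed cycle in `B`.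
  module Escape {B} (acyclic : ∀ a → B a ≡ true → ¬ Walk G src tgt B (tgt a) (src a))
    (X : Subset (n G)) (entered : ∀ v → (v ∈ᵇ X) ≡ true → ∃[ a ] B a ≡ true × tgt a ≡ v × (src a ∈ᵇ X) ≡ true)
    {v₀} (v₀∈X : (v₀ ∈ᵇ X) ≡ true) where

    chain : ℕ → ∃[ v ] (v ∈ᵇ X) ≡ true
    chain zero    = v₀ , v₀∈X
    chain (suc i) with entered (proj₁ (chain i)) (proj₂ (chain i))
    ... | a , _ , _ , src∈X = src a , src∈X

    vertex : ℕ → Fin (n G)
    vertex i = proj₁ (chain i)

    backArc : ∀ i → ∃[ a ] B a ≡ true × tgt a ≡ vertex i × src a ≡ vertex (suc i)
    backArc i with entered (proj₁ (chain i)) (proj₂ (chain i))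
    ... | a , Ba , tgt≡ , _ = a , Ba , tgt≡ , refl

    walk : ∀ i o → Walk G src tgt B (vertex (o ℕ.+ i)) (vertex i)
    walk i zero    = stay
    walk i (suc o) with backArc (o ℕ.+ i)
    ... | a , Ba , tgt≡ , src≡ = subst (λ v → Walk G src tgt B v (vertex i)) src≡
      (step a Ba (subst (λ v → Walk G src tgt B v (vertex i)) (sym tgt≡) (walk i o)))

    impossible : ⊥
    impossible with Fin.pigeonhole (ℕ.n<1+n (n G)) (vertex ∘ toℕ)
    ... | i , j , i<j , vᵢ≡vⱼ with ℕ.m≤n⇒∃[o]m+o≡n i<j | backArc (toℕ i)
    -- With vᵢ = vⱼ, the walk from vⱼ to vᵢ₊₁ runs from the head of the arc vᵢ₊₁vᵢ to its tail.
    ...   | o , 1+i+o≡j | a , Ba , tgt≡ , src≡ = acyclic a Ba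
      (subst₂ (Walk G src tgt B)
        (trans (cong vertex (trans (ℕ.+-comm o _) 1+i+o≡j)) (trans (sym vᵢ≡vⱼ) (sym tgt≡)))
        (sym src≡) (walk (suc (toℕ i)) o))

  escape : ∀ {B} (η : Fin (n G) → ℤ) → IsBranching G src tgt B →
    (∀ v → U v ≡ true → Unentered G tgt B v → 0ℤ ℤ.< η v) →
    ∀ X → valid X ≡ true →
    (∃[ a ] B a ≡ true × enters X a ≡ true) ⊎ (∃[ v ] (v ∈ᵇ X) ≡ true × 0ℤ ℤ.< η v)
  escape {B} η (acyclic , _) rooted X X-valid
    with Fin.any? (λ a → (B a Bool.≟ true) ×-dec (enters X a Bool.≟ true))
       | Fin.any? (λ v → ((v ∈ᵇ X) Bool.≟ true) ×-dec (0ℤ ℤ.<? η v))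
  ... | yes arc | _        = inj₁ arc
  ... | no _    | yes root = inj₂ root
  ... | no noArc | no noRoot with valid⇒nonempty X X-valid
  ...   | v₀ , v₀∈X = ⊥-elim (Escape.impossible acyclic X entered v₀∈X)
    where
    entered : ∀ v → (v ∈ᵇ X) ≡ true → ∃[ a ] B a ≡ true × tgt a ≡ v × (src a ∈ᵇ X) ≡ true
    entered v v∈X with Fin.any? (λ a → (B a Bool.≟ true) ×-dec (tgt a ≟ v))
    ... | no none = contradiction (v , v∈X , rooted v (valid⇒⊆ X X-valid v∈X) (λ a Ba tgt≡v → none (a , Ba , tgt≡v))) noRoot
    ... | yes (a , Ba , refl) with src a ∈ᵇ X in src∈X
    ...   | true  = a , Ba , refl , src∈X
    ...   | false = contradiction (a , Ba , cong₂ _∧_ (cong not src∈X) v∈X) noArc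

  -- Weak duality for branchings

  -- With U = T this is q*; with U = S it is -p*.
  potential : (Subset (n G) → ℤ) → Fin (n G) → ℤ
  potential z v = Σℤ⟦ (λ X → valid X ∧ (v ∈ᵇ X)) ∣ z ⟧

  -- Every valid X is entered by an arc of B or contains a root of B, so its dual value z X is
  -- charged at least once on the right-hand side.
  weakDuality : ∀ z → (∀ X → valid X ≡ true → 0ℤ ℤ.≤ z X) →
    (∀ a → Σℤ⟦ (λ X → valid X ∧ enters X a) ∣ z ⟧ ℤ.≤ ℤ.+ w G a) →
    ∀ {B} (η : Fin (n G) → ℤ) → (∀ v → U v ≡ true → 0ℤ ℤ.≤ η v) → IsBranching G src tgt B →
    (∀ v → U v ≡ true → Unentered G tgt B v → 0ℤ ℤ.< η v) →
    Σℤ⟦ valid ∣ z ⟧ ℤ.≤ wB G B ℤ.+ Σℤ[ U ∣ (λ v → potential z v ℤ.* η v) ]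
  weakDuality z 0≤z packs {B} η 0≤η branching rooted = ℤ.≤-trans (∑-mono Xs charged)
    -- Exchanging the sums collects the charges by arc, where the dual constraint bounds them by
    -- w(a), and by vertex, where they add up to potential times η.
    (ℤ.≤-trans (ℤ.≤-reflexive (trans (∑-+ Xs _ _) (cong₂ ℤ._+_ (∑-swap Xs as arcCharge) (∑-swap Xs vs rootCharge))))
      (ℤ.+-mono-≤ (∑-mono as paid) (ℤ.≤-reflexive (∑-cong vs collected))))
    where
    open ∑ℤ
    Xs : List (Subset (n G))
    Xs = allSubsets (n G)
    as : List (Fin (m G))
    as = allFin (m G)
    vs : List (Fin (n G))
    vs = allFin (n G)

    arcCharge : Subset (n G) → Fin (m G) → ℤ
    arcCharge X a = if B a then (if valid X ∧ enters X a then z X else 0ℤ) else 0ℤ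
    rootCharge : Subset (n G) → Fin (n G) → ℤ
    rootCharge X v = if U v then (if valid X ∧ (v ∈ᵇ X) then z X else 0ℤ) ℤ.* η v else 0ℤ

    z-nonneg : ∀ X e → 0ℤ ℤ.≤ (if valid X ∧ e then z X else 0ℤ)
    z-nonneg X e with valid X in X-valid
    z-nonneg X true  | true  = 0≤z X X-valid
    z-nonneg X false | true  = ℤ.≤-refl
    z-nonneg X _     | false = ℤ.≤-refl

    *-nonneg : ∀ {i j} → 0ℤ ℤ.≤ i → 0ℤ ℤ.≤ j → 0ℤ ℤ.≤ i ℤ.* j
    *-nonneg {i} {j} 0≤i 0≤j = ℤ.*-monoʳ-≤-nonNeg j {{ℤ.nonNegative 0≤j}} 0≤i

    arcCharge-nonneg : ∀ X a → 0ℤ ℤ.≤ arcCharge X a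
    arcCharge-nonneg X a with B a
    ... | true  = z-nonneg X (enters X a)
    ... | false = ℤ.≤-refl

    rootCharge-nonneg : ∀ X v → 0ℤ ℤ.≤ rootCharge X v
    rootCharge-nonneg X v with U v in v∈U
    ... | true  = *-nonneg (z-nonneg X (v ∈ᵇ X)) (0≤η v v∈U)
    ... | false = ℤ.≤-refl

    arcCharge-full : ∀ X a → valid X ≡ true → B a ≡ true → enters X a ≡ true → arcCharge X a ≡ z X
    arcCharge-full X a X-valid Ba a-enters rewrite Ba | X-valid | a-enters = refl

    rootCharge-full : ∀ X v → valid X ≡ true → (v ∈ᵇ X) ≡ true → 0ℤ ℤ.< η v → z X ℤ.≤ rootCharge X v
    rootCharge-full X v X-valid v∈X 0<ηv =
      -- Integrality enters here: 0 < η v gives 1 ≤ η v, so z X ≤ z X · η v.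
      subst₂ ℤ._≤_ (ℤ.*-identityʳ (z X)) (sym (full (valid⇒⊆ X X-valid v∈X)))
        (ℤ.*-monoˡ-≤-nonNeg (z X) {{ℤ.nonNegative (0≤z X X-valid)}} (ℤ.i<j⇒suc[i]≤j 0<ηv))
      where
      full : U v ≡ true → rootCharge X v ≡ z X ℤ.* η v
      full v∈U rewrite v∈U | X-valid | v∈X = refl

    charged : ∀ X → (if valid X then z X else 0ℤ) ℤ.≤ ∑ as (arcCharge X) ℤ.+ ∑ vs (rootCharge X)
    charged X = byCases (valid X) refl
      where
      byCases : ∀ e → valid X ≡ e → (if e then z X else 0ℤ) ℤ.≤ ∑ as (arcCharge X) ℤ.+ ∑ vs (rootCharge X)
      byCases false _ = ℤ.+-mono-≤ (∑-nonneg as (arcCharge-nonneg X)) (∑-nonneg vs (rootCharge-nonneg X))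
      byCases true X-valid with escape η branching rooted X X-valid
      ... | inj₁ (a , Ba , a-enters) = subst (ℤ._≤ ∑ as (arcCharge X) ℤ.+ ∑ vs (rootCharge X)) (ℤ.+-identityʳ (z X))
        (ℤ.+-mono-≤ (subst (ℤ._≤ ∑ as (arcCharge X)) (arcCharge-full X a X-valid Ba a-enters) (term≤∑ (arcCharge-nonneg X) a))
          (∑-nonneg vs (rootCharge-nonneg X)))
      ... | inj₂ (v , v∈X , 0<ηv) = subst (ℤ._≤ ∑ as (arcCharge X) ℤ.+ ∑ vs (rootCharge X)) (ℤ.+-identityˡ (z X))
        (ℤ.+-mono-≤ (∑-nonneg as (arcCharge-nonneg X))
          (ℤ.≤-trans (rootCharge-full X v X-valid v∈X 0<ηv) (term≤∑ (rootCharge-nonneg X) v)))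

    paid : ∀ a → ∑ Xs (λ X → arcCharge X a) ℤ.≤ (if B a then ℤ.+ w G a else 0ℤ)
    paid a = subst (ℤ._≤ _) (sym (∑-if Xs (B a) _)) (bound (B a))
      where
      bound : ∀ e → (if e then Σℤ⟦ (λ X → valid X ∧ enters X a) ∣ z ⟧ else 0ℤ) ℤ.≤ (if e then ℤ.+ w G a else 0ℤ)
      bound true  = packs a
      bound false = ℤ.≤-refl

    collected : ∀ v → ∑ Xs (λ X → rootCharge X v) ≡ (if U v then potential z v ℤ.* η v else 0ℤ)
    collected v = trans (∑-if Xs (U v) _) (cong (λ i → if U v then i else 0ℤ) (∑-*ʳ Xs _ (η v)))

-- Branchings inside `x` with a prescribed root set

module Spanning (G : Net) (src tgt : Fin (m G) → Fin (n G)) (U : Fin (n G) → Bool)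
  (x : ArcSet G) (root : Fin (n G) → Bool)
  (extend : ∀ X → Oriented.valid G src tgt U X ≡ true → (∀ v → (v ∈ᵇ X) ≡ true → root v ≡ false) →
    ∃[ a ] x a ≡ true × U (src a) ≡ true × Oriented.enters G src tgt U X a ≡ true) where
  open Oriented G src tgt U

  -- X is the set of vertices still to be reached; rank makes acyclicity a local condition.
  record Partial (X : Subset (n G)) : Set where
    field
      B         : ArcSet G
      rank      : Fin (n G) → ℕ
      unreached : ∀ v → (v ∈ᵇ X) ≡ true → U v ≡ true × root v ≡ false
      available : ∀ a → B a ≡ true → x a ≡ true × U (src a) ≡ true × U (tgt a) ≡ true
      -- Keeps old arcs away from the head of the next arc: that head is then entered only once, and
      -- giving it a new rank disturbs no old arc.
      outside   : ∀ a → B a ≡ true → (src a ∈ᵇ X) ≡ false × (tgt a ∈ᵇ X) ≡ false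
      nonroot   : ∀ a → B a ≡ true → root (tgt a) ≡ false
      unique    : ∀ a a′ → B a ≡ true → B a′ ≡ true → tgt a ≡ tgt a′ → a ≡ a′
      reached   : ∀ v → U v ≡ true → root v ≡ false → (v ∈ᵇ X) ≡ false → ∃[ a ] B a ≡ true × tgt a ≡ v
      ranked    : ∀ a → B a ≡ true → rank (src a) ℕ.< rank (tgt a)

  start : Partial (tabulate (λ v → U v ∧ not (root v)))
  start = record
    { B = λ _ → false ; rank = λ _ → 0
    ; unreached = λ v v∈ → let Uv , ¬root = ∧-elim (trans (sym (lookup∘tabulate _ v)) v∈) in Uv , not-true ¬root
    ; available = λ _ () ; outside = λ _ () ; nonroot = λ _ () ; unique = λ _ _ ()
    ; reached = λ v Uv ¬root v∉ → ⊥-elim (true≢false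
        (trans (lookup∘tabulate (λ v → U v ∧ not (root v)) v) (cong₂ _∧_ Uv (cong not ¬root))) v∉)
    ; ranked = λ _ () }

  module Extension {X} (P : Partial X) (a : Fin (m G)) (xa : x a ≡ true) (Usrc : U (src a) ≡ true)
    (src∉X : (src a ∈ᵇ X) ≡ false) (tgt∈X : (tgt a ∈ᵇ X) ≡ true) where
    open Partial P

    X′ : Subset (n G)
    X′ = X [ tgt a ]≔ false

    B′ : ArcSet G
    B′ b = B b ∨ (a == b)

    B′-elim : ∀ b → B′ b ≡ true → B b ≡ true ⊎ a ≡ b
    B′-elim b B′b with B b
    ... | true  = inj₁ refl
    ... | false = inj₂ (==-sound B′b)

    B⊆B′ : ∀ {b} → B b ≡ true → B′ b ≡ true
    B⊆B′ Bb rewrite Bb = refl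

    a∈B′ : B′ a ≡ true
    a∈B′ rewrite ==-refl a = Bool.∨-zeroʳ (B a)

    X′⊆X : ∀ v → (v ∈ᵇ X′) ≡ true → (v ∈ᵇ X) ≡ true
    X′⊆X v v∈X′ with v ≟ tgt a
    ... | yes refl  = tgt∈X
    ... | no v≢tgt = trans (sym (lookup∘update′ v≢tgt X false)) v∈X′

    ∉X⇒∉X′ : ∀ v → (v ∈ᵇ X) ≡ false → (v ∈ᵇ X′) ≡ false
    ∉X⇒∉X′ v v∉X with v ∈ᵇ X′ in v∈X′
    ... | false = refl
    ... | true  = ⊥-elim (true≢false (X′⊆X v v∈X′) v∉X)

    ∉X⇒≢tgt : ∀ v → (v ∈ᵇ X) ≡ false → v ≢ tgt a
    ∉X⇒≢tgt v v∉X refl = true≢false tgt∈X v∉X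

    rank′ : Fin (n G) → ℕ
    rank′ v with v ≟ tgt a
    ... | yes _ = suc (rank (src a))
    ... | no  _ = rank v

    rank′-old : ∀ v → (v ∈ᵇ X) ≡ false → rank′ v ≡ rank v
    rank′-old v v∉X with v ≟ tgt a
    ... | yes v≡tgt = ⊥-elim (∉X⇒≢tgt v v∉X v≡tgt)
    ... | no  _     = refl

    rank′-new : rank′ (tgt a) ≡ suc (rank (src a))
    rank′-new with tgt a ≟ tgt a
    ... | yes _    = refl
    ... | no tgt≢ = contradiction refl tgt≢

    extended : Partial X′
    extended = record
      { B = B′ ; rank = rank′
      ; unreached = λ v v∈X′ → unreached v (X′⊆X v v∈X′)
      ; available = available′ ; outside = outside′ ; nonroot = nonroot′
      ; unique = unique′ ; reached = reached′ ; ranked = ranked′ }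
      where
      available′ : ∀ b → B′ b ≡ true → x b ≡ true × U (src b) ≡ true × U (tgt b) ≡ true
      available′ b B′b with B′-elim b B′b
      ... | inj₁ Bb   = available b Bb
      ... | inj₂ refl = xa , Usrc , proj₁ (unreached (tgt a) tgt∈X)

      outside′ : ∀ b → B′ b ≡ true → (src b ∈ᵇ X′) ≡ false × (tgt b ∈ᵇ X′) ≡ false
      outside′ b B′b with B′-elim b B′b
      ... | inj₁ Bb   = ∉X⇒∉X′ _ (proj₁ (outside b Bb)) , ∉X⇒∉X′ _ (proj₂ (outside b Bb))
      ... | inj₂ refl = ∉X⇒∉X′ _ src∉X , lookup∘update (tgt a) X false

      nonroot′ : ∀ b → B′ b ≡ true → root (tgt b) ≡ false
      nonroot′ b B′b with B′-elim b B′b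
      ... | inj₁ Bb   = nonroot b Bb
      ... | inj₂ refl = proj₂ (unreached (tgt a) tgt∈X)

      unique′ : ∀ b b′ → B′ b ≡ true → B′ b′ ≡ true → tgt b ≡ tgt b′ → b ≡ b′
      unique′ b b′ B′b B′b′ tgt≡ with B′-elim b B′b | B′-elim b′ B′b′
      ... | inj₁ Bb   | inj₁ Bb′  = unique b b′ Bb Bb′ tgt≡
      ... | inj₁ Bb   | inj₂ refl = ⊥-elim (∉X⇒≢tgt _ (proj₂ (outside b Bb)) tgt≡)
      ... | inj₂ refl | inj₁ Bb′  = ⊥-elim (∉X⇒≢tgt _ (proj₂ (outside b′ Bb′)) (sym tgt≡))
      ... | inj₂ refl | inj₂ refl = refl

      reached′ : ∀ v → U v ≡ true → root v ≡ false → (v ∈ᵇ X′) ≡ false → ∃[ b ] B′ b ≡ true × tgt b ≡ v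
      reached′ v Uv ¬root v∉X′ with v ≟ tgt a
      ... | yes v≡tgt = a , a∈B′ , sym v≡tgt
      ... | no v≢tgt with reached v Uv ¬root (trans (sym (lookup∘update′ v≢tgt X false)) v∉X′)
      ...   | b , Bb , tgt≡v = b , B⊆B′ Bb , tgt≡v

      ranked′ : ∀ b → B′ b ≡ true → rank′ (src b) ℕ.< rank′ (tgt b)
      ranked′ b B′b with B′-elim b B′b
      ... | inj₁ Bb   = subst₂ ℕ._<_
        (sym (rank′-old _ (proj₁ (outside b Bb)))) (sym (rank′-old _ (proj₂ (outside b Bb)))) (ranked b Bb)
      ... | inj₂ refl = subst₂ ℕ._<_ (sym (rank′-old _ src∉X)) (sym rank′-new) (ℕ.n<1+n _)

  -- The unreached vertices form a subset of `U` without roots, so the cut condition `extend`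
  -- supplies an arc into it from a reached vertex. Each added arc shrinks the set, which gives
  -- termination.
  grow : ∀ X → Acc ℕ._<_ ∣ X ∣ → Partial X → ∃[ Y ] Partial Y × (∀ v → (v ∈ᵇ Y) ≡ false)
  grow X (acc smaller) P with Fin.any? (λ v → (v ∈ᵇ X) Bool.≟ true)
  ... | no  empty = X , P , λ v → Bool.¬-not (λ v∈X → empty (v , v∈X))
  ... | yes (v , v∈X)
    with extend X (valid⁺ X v∈X (λ u u∈X → proj₁ (Partial.unreached P u u∈X))) (λ u u∈X → proj₂ (Partial.unreached P u u∈X))
  ...   | a , xa , Usrc , a-enters =
    grow _ (smaller (∣∣-remove X (tgt a) tgt∈X)) (Extension.extended P a xa Usrc src∉X tgt∈X)
    where
    src∉X : (src a ∈ᵇ X) ≡ false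
    src∉X = not-true (proj₁ (∧-elim a-enters))
    tgt∈X : (tgt a ∈ᵇ X) ≡ true
    tgt∈X = proj₂ (∧-elim {not (src a ∈ᵇ X)} a-enters)

  spanning : ∃[ B ] (∀ a → B a ≡ true → x a ≡ true × U (src a) ≡ true × U (tgt a) ≡ true) ×
    IsBranching G src tgt B ×
    (∀ v → U v ≡ true → Unentered G tgt B v ⇔′ (root v ≡ true))
  spanning with grow _ (<-wellFounded _) start
  ... | Y , P , Y-empty = B , available , (acyclic , unique) , λ v Uv → unentered⇒root v Uv , root⇒unentered v
    where
    open Partial P
    -- Every arc raises the rank strictly, so no walk can lead from the head of an arc back to its
    -- tail.
    climbs : ∀ {u v} → Walk G src tgt B u v → rank u ℕ.≤ rank v
    climbs stay          = ℕ.≤-refl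
    climbs (step a Ba p) = ℕ.≤-trans (ℕ.<⇒≤ (ranked a Ba)) (climbs p)

    acyclic : ∀ a → B a ≡ true → ¬ Walk G src tgt B (tgt a) (src a)
    acyclic a Ba p = ℕ.<-irrefl refl (ℕ.<-≤-trans (ranked a Ba) (climbs p))

    unentered⇒root : ∀ v → U v ≡ true → Unentered G tgt B v → root v ≡ true
    unentered⇒root v Uv unentered with root v in ¬root
    ... | true  = refl
    ... | false with reached v Uv ¬root (Y-empty v)
    ...   | a , Ba , tgt≡v = ⊥-elim (unentered a Ba tgt≡v)

    root⇒unentered : ∀ v → root v ≡ true → Unentered G tgt B v
    root⇒unentered v v-root a Ba refl = true≢false v-root (nonroot a Ba)

-- If `P` and `x` had no common arc, every term of the sum would be 0.
covering-arc : ∀ {k} (P x : Fin k → Bool) → 1ℚ ℚ.≤ Σℚ[ P ∣ (λ a → bℚ (x a)) ] → ∃[ a ] P a ≡ true × x a ≡ true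
covering-arc {k} P x 1≤ with Fin.any? (λ a → (P a Bool.≟ true) ×-dec (x a Bool.≟ true))
... | yes found = found
... | no none = contradiction (subst (1ℚ ℚ.≤_) (trans (∑ℚ.∑-cong (allFin k) vanishes) (∑ℚ.∑-zero (allFin k))) 1≤)
  (λ 1≤0 → ℚ.<-irrefl refl (ℚ.<-≤-trans (ℚ.positive⁻¹ 1ℚ) 1≤0))
  where
  vanishes : ∀ a → (if P a then bℚ (x a) else 0ℚ) ≡ 0ℚ
  vanishes a with P a in Pa | x a in xa
  ... | true  | true  = ⊥-elim (none (a , Pa , xa))
  ... | true  | false = refl
  ... | false | _     = refl

positive? : ℤ → Bool
positive? i = does (0ℤ ℤ.<? i)

positive?-sound : ∀ i → positive? i ≡ true → 0ℤ ℤ.< i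
positive?-sound i eq with 0ℤ ℤ.<? i
... | yes 0<i = 0<i

positive?-complete : ∀ i → 0ℤ ℤ.< i → positive? i ≡ true
positive?-complete i 0<i with 0ℤ ℤ.<? i
... | yes _  = refl
... | no 0≮i = contradiction 0<i 0≮i

S∩T : ∀ G v → inS G v ≡ true → inT G v ≡ true → ⊥
S∩T G v v∈S v∈T = true≢false v∈S (not-true v∈T)

tl∈S : ∀ G a → isST G a ≡ true → inS G (tl G a) ≡ true
tl∈S G a = proj₁ ∘ ∧-elim

hd∈T : ∀ G a → isST G a ≡ true → inT G (hd G a) ≡ true
hd∈T G a = proj₂ ∘ ∧-elim {inS G (tl G a)}

reducedCost : ∀ G → (p q : Fin (n G) → ℤ) → Fin (m G) → ℤ
reducedCost G p q a = (ℤ.+ w G a) ℤ.+ p (tl G a) ℤ.- q (hd G a)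

-- Boundary of a flow, and the structure of feasible 0/1 solutions of (P)

module Boundary (G : Net) (ξ : Flow G) where
  open ∑ℤ

  degree : (Fin (m G) → Fin (n G)) → Fin (n G) → ℤ
  degree end v = Σℤ[ (λ a → isST G a ∧ ξ a ∧ (end a == v)) ∣ (λ _ → ℤ.+ 1) ]

  degree-zero : ∀ end v → (∀ a → isST G a ≡ true → end a ≢ v) → degree end v ≡ 0ℤ
  degree-zero end v avoids = trans (∑-cong (allFin (m G)) vanishes) (∑-zero (allFin (m G)))
    where
    vanishes : ∀ a → (if isST G a ∧ ξ a ∧ (end a == v) then ℤ.+ 1 else 0ℤ) ≡ 0ℤ
    vanishes a with isST G a in ST | ξ a | end a ≟ v
    ... | true  | true  | yes end≡v = ⊥-elim (avoids a ST end≡v)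
    ... | true  | true  | no _      = refl
    ... | true  | false | _         = refl
    ... | false | _     | _         = refl

  0≤unit : ∀ e → 0ℤ ℤ.≤ (if e then ℤ.+ 1 else 0ℤ)
  0≤unit true  = ℤ.+≤+ ℕ.z≤n
  0≤unit false = ℤ.≤-refl

  degree-nonneg : ∀ end v → 0ℤ ℤ.≤ degree end v
  degree-nonneg end v = ∑-nonneg (allFin (m G)) (λ a → 0≤unit (isST G a ∧ ξ a ∧ (end a == v)))

  degree-positive : ∀ end a → isST G a ≡ true → ξ a ≡ true → 0ℤ ℤ.< degree end (end a)
  degree-positive end a ST ξa = ℤ.suc[i]≤j⇒i<j (subst (ℤ._≤ degree end (end a))
    (cong (λ e → if e then ℤ.+ 1 else 0ℤ) (cong₂ _∧_ ST (cong₂ _∧_ ξa (==-refl (end a)))))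
    (term≤∑ (λ b → 0≤unit (isST G b ∧ ξ b ∧ (end b == end a))) a))

  -- Double counting: a selected arc contributes `q` once, at its chosen end.
  dot-degree : ∀ end (U : Fin (n G) → Bool) → (∀ a → isST G a ≡ true → U (end a) ≡ true) → ∀ q →
    Σℤ[ U ∣ (λ v → q v ℤ.* degree end v) ] ≡ Σℤ[ (λ a → isST G a ∧ ξ a) ∣ (λ a → q (end a)) ]
  dot-degree end U ends q =
    trans (∑-cong vs (λ v → trans (cong (λ i → if U v then i else 0ℤ) (sym (∑-*ˡ as (q v) _))) (sym (∑-if as (U v) _))))
      (trans (∑-swap vs as _) (∑-cong as collect))
    where
    as : List (Fin (m G))
    as = allFin (m G)
    vs : List (Fin (n G))
    vs = allFin (n G)
    term : Fin (m G) → Fin (n G) → ℤ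
    term a v = if U v then q v ℤ.* (if isST G a ∧ ξ a ∧ (end a == v) then ℤ.+ 1 else 0ℤ) else 0ℤ
    zero-term : ∀ e i → (if e then i ℤ.* 0ℤ else 0ℤ) ≡ 0ℤ
    zero-term true  i = ℤ.*-zeroʳ i
    zero-term false i = refl
    local : ∀ a → isST G a ≡ true → ∀ v →
      (if U v then q v ℤ.* (if end a == v then ℤ.+ 1 else 0ℤ) else 0ℤ) ≡ (if end a == v then q v else 0ℤ)
    local a ST v with end a ≟ v
    ... | no _ = zero-term (U v) (q v)
    ... | yes refl rewrite ends a ST = ℤ.*-identityʳ (q v)
    collect : ∀ a → ∑ vs (term a) ≡ (if isST G a ∧ ξ a then q (end a) else 0ℤ)
    collect a with isST G a in ST | ξ a
    ... | true  | true  = trans (∑-cong vs (local a ST)) (∑-allFin-point (end a) q)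
    ... | true  | false = trans (∑-cong vs (λ v → zero-term (U v) (q v))) (∑-zero vs)
    ... | false | _     = trans (∑-cong vs (λ v → zero-term (U v) (q v))) (∑-zero vs)

  -- No arc of A[S,T] enters S, so only the outgoing term of the boundary survives there.
  ∂-S : ∀ v → inS G v ≡ true → ∂ G ξ v ≡ degree (tl G) v
  ∂-S v v∈S rewrite degree-zero (hd G) v (λ a ST hd≡v → S∩T G v v∈S (subst (λ u → inT G u ≡ true) hd≡v (hd∈T G a ST))) =
    ℤ.+-identityʳ _

  ∂⁻-T : ∀ v → inT G v ≡ true → ∂⁻ G ξ v ≡ degree (hd G) v
  ∂⁻-T v v∈T rewrite degree-zero (tl G) v (λ a ST tl≡v → S∩T G v (subst (λ u → inS G u ≡ true) tl≡v (tl∈S G a ST)) v∈T) =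
    trans (cong ℤ.-_ (ℤ.+-identityˡ _)) (ℤ.neg-involutive _)

  dot-cong : ∀ (U : Fin (n G) → Bool) (q : Fin (n G) → ℤ) {η ζ : Fin (n G) → ℤ} → (∀ v → U v ≡ true → η v ≡ ζ v) →
    Σℤ[ U ∣ (λ v → q v ℤ.* η v) ] ≡ Σℤ[ U ∣ (λ v → q v ℤ.* ζ v) ]
  dot-cong U q {η} {ζ} η≡ζ = ∑-cong (allFin (n G)) same
    where
    same : ∀ v → (if U v then q v ℤ.* η v else 0ℤ) ≡ (if U v then q v ℤ.* ζ v else 0ℤ)
    same v with U v in v∈U
    ... | true  = cong (q v ℤ.*_) (η≡ζ v v∈U)
    ... | false = refl

  dotS-∂ : ∀ p → dotS G p (∂ G ξ) ≡ Σℤ[ (λ a → isST G a ∧ ξ a) ∣ (λ a → p (tl G a)) ]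
  dotS-∂ p = trans (dot-cong (inS G) p ∂-S) (dot-degree (tl G) (inS G) (tl∈S G) p)

  dotT-∂⁻ : ∀ q → dotT G q (∂⁻ G ξ) ≡ Σℤ[ (λ a → isST G a ∧ ξ a) ∣ (λ a → q (hd G a)) ]
  dotT-∂⁻ q = trans (dot-cong (inT G) q ∂⁻-T) (dot-degree (hd G) (inT G) (hd∈T G) q)

  -- Summation by parts: reduced costs and weights of a flow differ only by boundary terms. These
  -- are the terms that cancel against the ones subtracted from g_S and added to g_T.
  flowCost-reduced : ∀ p q →
    Σℤ[ (λ a → isST G a ∧ ξ a) ∣ reducedCost G p q ] ≡ flowCost G ξ ℤ.+ dotS G p (∂ G ξ) ℤ.- dotT G q (∂⁻ G ξ)
  flowCost-reduced p q = trans (∑-cong as split)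
    (trans (∑-+ as _ _) (cong₂ ℤ._+_
      (trans (∑-+ as _ _) (cong (λ i → flowCost G ξ ℤ.+ i) (sym (dotS-∂ p))))
      (trans (∑-*ˡ as (ℤ.- 1ℤ) _) (trans (ℤ.-1*i≡-i _) (cong ℤ.-_ (sym (dotT-∂⁻ q)))))))
    where
    as : List (Fin (m G))
    as = allFin (m G)
    split : ∀ a → (if isST G a ∧ ξ a then reducedCost G p q a else 0ℤ) ≡
      (if isST G a ∧ ξ a then ℤ.+ w G a else 0ℤ) ℤ.+ (if isST G a ∧ ξ a then p (tl G a) else 0ℤ)
        ℤ.+ (ℤ.- 1ℤ) ℤ.* (if isST G a ∧ ξ a then q (hd G a) else 0ℤ)
    split a with isST G a ∧ ξ a
    ... | true  = cong (λ i → (ℤ.+ w G a) ℤ.+ p (tl G a) ℤ.+ i) (sym (ℤ.-1*i≡-i (q (hd G a))))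
    ... | false = refl

  -- The constraint of (P) for a rootless X ⊆ S yields an arc of `ξ` leaving X. A head in T would
  -- put it in A[S,T] and make its tail a root, so the head is in S and the reversed arc enters X
  -- from within S.
  spanningS : PFeasible G (λ a → bℚ (ξ a)) →
    ∃[ B ] CobranchS G B (∂ G ξ) × (∀ a → B a ≡ true → ξ a ≡ true)
  spanningS (covers , _ , _) with Spanning.spanning G (hd G) (tl G) (inS G) ξ (positive? ∘ ∂ G ξ) extend
    where
    extend : ∀ X → validS G X ≡ true → (∀ v → (v ∈ᵇ X) ≡ true → positive? (∂ G ξ v) ≡ false) →
      ∃[ a ] ξ a ≡ true × inS G (hd G a) ≡ true × not (hd G a ∈ᵇ X) ∧ (tl G a ∈ᵇ X) ≡ true
    extend X X-valid nonroot with covering-arc (outOf G X) ξ (covers X X-valid)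
    ... | a , leaves , ξa with inS G (hd G a) in head∈S
    ...   | true  = a , ξa , head∈S , trans (Bool.∧-comm (not (hd G a ∈ᵇ X)) (tl G a ∈ᵇ X)) leaves
    ...   | false = ⊥-elim (true≢false
      (positive?-complete _ (subst (0ℤ ℤ.<_) (sym (∂-S _ tail∈S))
        (degree-positive (tl G) a (cong₂ _∧_ tail∈S (not-false head∈S)) ξa)))
      (nonroot _ tl∈X))
      where
      tl∈X : (tl G a ∈ᵇ X) ≡ true
      tl∈X = proj₁ (∧-elim leaves)
      tail∈S : inS G (tl G a) ≡ true
      tail∈S = Oriented.valid⇒⊆ G (hd G) (tl G) (inS G) X X-valid tl∈X
  ... | B , within , branching , roots = B ,
    ((λ a Ba → proj₂ (proj₂ (within a Ba)) , proj₁ (proj₂ (within a Ba))) , branching ,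
     λ v v∈S → positive?-sound _ ∘ proj₁ (roots v v∈S) , proj₂ (roots v v∈S) ∘ positive?-complete _) ,
    λ a Ba → proj₁ (within a Ba)

  spanningT : PFeasible G (λ a → bℚ (ξ a)) →
    ∃[ B ] BranchT G B (∂⁻ G ξ) × (∀ a → B a ≡ true → ξ a ≡ true)
  spanningT (_ , covers , _) with Spanning.spanning G (tl G) (hd G) (inT G) ξ (positive? ∘ ∂⁻ G ξ) extend
    where
    extend : ∀ X → validT G X ≡ true → (∀ v → (v ∈ᵇ X) ≡ true → positive? (∂⁻ G ξ v) ≡ false) →
      ∃[ a ] ξ a ≡ true × inT G (tl G a) ≡ true × into G X a ≡ true
    extend X X-valid nonroot with covering-arc (into G X) ξ (covers X X-valid)
    ... | a , entering , ξa with inS G (tl G a) in tail∈S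
    ...   | false = a , ξa , not-false tail∈S , entering
    -- An arc from S into the rootless set X would give its head a positive value of -∂ξ and so make
    -- it a root.
    ...   | true  = ⊥-elim (true≢false
      (positive?-complete _ (subst (0ℤ ℤ.<_) (sym (∂⁻-T _ head∈T))
        (degree-positive (hd G) a (cong₂ _∧_ tail∈S head∈T) ξa)))
      (nonroot _ hd∈X))
      where
      hd∈X : (hd G a ∈ᵇ X) ≡ true
      hd∈X = proj₂ (∧-elim {not (tl G a ∈ᵇ X)} entering)
      head∈T : inT G (hd G a) ≡ true
      head∈T = Oriented.valid⇒⊆ G (tl G) (hd G) (inT G) X X-valid hd∈X
  ... | B , within , branching , roots = B ,
    ((λ a Ba → proj₁ (proj₂ (within a Ba)) , proj₂ (proj₂ (within a Ba))) , branching ,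
     λ v v∈T → positive?-sound _ ∘ proj₁ (roots v v∈T) , proj₂ (roots v v∈T) ∘ positive?-complete _) ,
    λ a Ba → proj₁ (within a Ba)

-- The contribution of a single arc when three disjoint arc sets lie inside a fourth: applied to the
-- flow, the cobranching and the branching inside `x`.
disjoint-≤ : ∀ {d e f g} {i : ℤ} → 0ℤ ℤ.≤ i →
  (d ≡ true → g ≡ true) → (e ≡ true → g ≡ true) → (f ≡ true → g ≡ true) →
  (d ≡ true → e ≡ true → ⊥) → (d ≡ true → f ≡ true → ⊥) → (e ≡ true → f ≡ true → ⊥) →
  (if d then i else 0ℤ) ℤ.+ (if e then i else 0ℤ) ℤ.+ (if f then i else 0ℤ) ℤ.≤ (if g then i else 0ℤ)
disjoint-≤ {true}  {true}          _ _ _ _ ¬de _ _ = ⊥-elim (¬de refl refl)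
disjoint-≤ {true}  {false} {true}  _ _ _ _ _ ¬df _ = ⊥-elim (¬df refl refl)
disjoint-≤ {false} {true}  {true}  _ _ _ _ _ _ ¬ef = ⊥-elim (¬ef refl refl)
disjoint-≤ {true}  {false} {false} {g} {i} _ d⇒g _ _ _ _ _ rewrite d⇒g refl =
  ℤ.≤-reflexive (trans (ℤ.+-identityʳ (i ℤ.+ 0ℤ)) (ℤ.+-identityʳ i))
disjoint-≤ {false} {true}  {false} {g} {i} _ _ e⇒g _ _ _ _ rewrite e⇒g refl =
  ℤ.≤-reflexive (trans (ℤ.+-identityʳ (0ℤ ℤ.+ i)) (ℤ.+-identityˡ i))
disjoint-≤ {false} {false} {true}  {g} {i} _ _ _ f⇒g _ _ _ rewrite f⇒g refl = ℤ.≤-reflexive (ℤ.+-identityˡ i)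
disjoint-≤ {false} {false} {false} {true}  0≤i _ _ _ _ _ _ = 0≤i
disjoint-≤ {false} {false} {false} {false} _ _ _ _ _ _ _ = ℤ.≤-refl

-- Lower bounds supplied by a feasible dual solution

module Bounds (G : Net) (y z : Subset (n G) → ℤ) (feasible : DFeasible G (λ X → toℚ (y X)) (λ X → toℚ (z X))) where
  open ∑ℤ
  module OS = Oriented G (hd G) (tl G) (inS G)
  module OT = Oriented G (tl G) (hd G) (inT G)

  p q : Fin (n G) → ℤ
  p = pStar G y
  q = qStar G z

  Y Z : ℤ
  Y = Σℤ⟦ validS G ∣ y ⟧
  Z = Σℤ⟦ validT G ∣ z ⟧

  leaving entering : Fin (m G) → ℤ
  leaving  a = Σℤ⟦ (λ X → validS G X ∧ outOf G X a) ∣ y ⟧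
  entering a = Σℤ⟦ (λ X → validT G X ∧ into G X a) ∣ z ⟧

  packs : ∀ a → leaving a ℤ.+ entering a ℤ.≤ ℤ.+ w G a
  packs a = toℚ-cancel-≤ (subst (ℚ._≤ toℚ (ℤ.+ w G a))
    (trans (cong₂ ℚ._+_ (∑-toℚ (allSubsets (n G)) _ y) (∑-toℚ (allSubsets (n G)) _ z)) (sym (toℚ-+ (leaving a) (entering a))))
    (proj₁ feasible a))

  0≤y : ∀ X → validS G X ≡ true → 0ℤ ℤ.≤ y X
  0≤y X X-valid = toℚ-cancel-≤ (proj₁ (proj₂ feasible) X X-valid)

  0≤z : ∀ X → validT G X ≡ true → 0ℤ ℤ.≤ z X
  0≤z X X-valid = toℚ-cancel-≤ (proj₂ (proj₂ feasible) X X-valid)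

  Σ-nonneg : ∀ (P Q : Subset (n G) → Bool) f → (∀ X → P X ≡ true → 0ℤ ℤ.≤ f X) → 0ℤ ℤ.≤ Σℤ⟦ (λ X → P X ∧ Q X) ∣ f ⟧
  Σ-nonneg P Q f 0≤f = ∑-nonneg (allSubsets (n G)) nonneg
    where
    nonneg : ∀ X → 0ℤ ℤ.≤ (if P X ∧ Q X then f X else 0ℤ)
    nonneg X with P X in PX | Q X
    ... | true  | true  = 0≤f X PX
    ... | true  | false = ℤ.≤-refl
    ... | false | _     = ℤ.≤-refl

  packsS : ∀ a → Σℤ⟦ (λ X → OS.valid X ∧ OS.enters X a) ∣ y ⟧ ℤ.≤ ℤ.+ w G a
  packsS a = subst (ℤ._≤ ℤ.+ w G a)
    (∑-cong (allSubsets (n G)) (λ X → cong (λ e → if validS G X ∧ e then y X else 0ℤ) (Bool.∧-comm (tl G a ∈ᵇ X) _)))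
    (ℤ.≤-trans (ℤ.≤-trans (ℤ.≤-reflexive (sym (ℤ.+-identityʳ (leaving a))))
      (ℤ.+-monoʳ-≤ (leaving a) (Σ-nonneg (validT G) (λ X → into G X a) z 0≤z))) (packs a))

  packsT : ∀ a → Σℤ⟦ (λ X → OT.valid X ∧ OT.enters X a) ∣ z ⟧ ℤ.≤ ℤ.+ w G a
  packsT a = ℤ.≤-trans (ℤ.≤-trans (ℤ.≤-reflexive (sym (ℤ.+-identityˡ (entering a))))
      (ℤ.+-monoˡ-≤ (entering a) (Σ-nonneg (validS G) (λ X → outOf G X a) y 0≤y))) (packs a)

  lowerT : ∀ {B} ζ → (∀ v → inT G v ≡ true → 0ℤ ℤ.≤ ζ v) → BranchT G B ζ → Z ℤ.≤ wB G B ℤ.+ dotT G q ζ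
  lowerT ζ 0≤ζ (_ , branching , roots) = OT.weakDuality z 0≤z packsT ζ 0≤ζ branching (λ v v∈T → proj₁ (roots v v∈T))

  lowerS : ∀ {B} η → (∀ v → inS G v ≡ true → 0ℤ ℤ.≤ η v) → CobranchS G B η → Y ℤ.≤ wB G B ℤ.- dotS G p η
  lowerS {B} η 0≤η (_ , branching , roots) = subst (λ i → Y ℤ.≤ wB G B ℤ.+ i) negated
    (OS.weakDuality y 0≤y packsS η 0≤η branching (λ v v∈S → proj₁ (roots v v∈S)))
    where
    flip : ∀ e i j → (if e then i ℤ.* j else 0ℤ) ≡ ℤ.- 1ℤ ℤ.* (if e then ℤ.- i ℤ.* j else 0ℤ)
    flip true  i j = sym (trans (ℤ.-1*i≡-i (ℤ.- i ℤ.* j))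
      (trans (cong ℤ.-_ (sym (ℤ.neg-distribˡ-* i j))) (ℤ.neg-involutive (i ℤ.* j))))
    flip false i j = refl
    negated : Σℤ[ inS G ∣ (λ v → OS.potential y v ℤ.* η v) ] ≡ ℤ.- dotS G p η
    negated = trans (∑-cong (allFin (n G)) (λ v → flip (inS G v) (OS.potential y v) (η v)))
      (trans (∑-*ˡ (allFin (n G)) (ℤ.- 1ℤ) _) (ℤ.-1*i≡-i (dotS G p η)))

  GT-lower : ∀ {ζ c} → GT G ζ c → Z ℤ.≤ c ℤ.+ dotT G q ζ
  GT-lower {ζ} (0≤ζ , B , branch , refl , _) = lowerT ζ 0≤ζ branch

  GS-lower : ∀ {η c} → GS G η c → Y ℤ.≤ c ℤ.- dotS G p η
  GS-lower {η} (0≤η , B , cobranch , refl , _) = lowerS η 0≤η cobranch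

  -- For uv in A[S,T] a set S' ⊆ S never contains v, so uv leaves S' exactly when u ∈ S'; likewise
  -- uv enters T' ⊆ T exactly when v ∈ T'. The dual constraint at uv therefore reads -p*(u) + q*(v)
  -- ≤ w(uv).
  reducedCost-nonneg : ∀ a → isST G a ≡ true → 0ℤ ℤ.≤ reducedCost G p q a
  reducedCost-nonneg a ST = subst (0ℤ ℤ.≤_) rearrange (ℤ.i≤j⇒0≤j-i (packs a))
    where
    leave : ∀ X → validS G X ∧ outOf G X a ≡ validS G X ∧ (tl G a ∈ᵇ X)
    leave X with validS G X in X-valid | hd G a ∈ᵇ X in hd∈X
    ... | false | _     = refl
    ... | true  | false = Bool.∧-identityʳ _
    ... | true  | true  = ⊥-elim (true≢false (OS.valid⇒⊆ X X-valid hd∈X) (not-true (hd∈T G a ST)))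
    enter : ∀ X → validT G X ∧ into G X a ≡ validT G X ∧ (hd G a ∈ᵇ X)
    enter X with validT G X in X-valid | tl G a ∈ᵇ X in tl∈X
    ... | false | _     = refl
    ... | true  | false = refl
    ... | true  | true  = ⊥-elim (true≢false (tl∈S G a ST) (not-true (OT.valid⇒⊆ X X-valid tl∈X)))
    rearrange : ℤ.+ w G a ℤ.- (leaving a ℤ.+ entering a) ≡ reducedCost G p q a
    rearrange = trans
      (cong (λ i → ℤ.+ w G a ℤ.- i) (cong₂ ℤ._+_
        (∑-cong (allSubsets (n G)) (λ X → cong (λ e → if e then y X else 0ℤ) (leave X)))
        (∑-cong (allSubsets (n G)) (λ X → cong (λ e → if e then z X else 0ℤ) (enter X)))))
      (trans (cong (λ i → ℤ.+ w G a ℤ.+ i) (ℤ.neg-distrib-+ (OS.potential y (tl G a)) (q (hd G a))))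
        (sym (ℤ.+-assoc (ℤ.+ w G a) (p (tl G a)) (ℤ.- q (hd G a)))))

  flowTerm : Flow G → Fin (m G) → ℤ
  flowTerm ξ a = if isST G a ∧ ξ a then reducedCost G p q a else 0ℤ

  flowTerm-nonneg : ∀ ξ a → 0ℤ ℤ.≤ flowTerm ξ a
  flowTerm-nonneg ξ a = byCases (isST G a) (ξ a) refl
    where
    byCases : ∀ d e → isST G a ≡ d → 0ℤ ℤ.≤ (if d ∧ e then reducedCost G p q a else 0ℤ)
    byCases true  true  ST = reducedCost-nonneg a ST
    byCases true  false _  = ℤ.≤-refl
    byCases false _     _  = ℤ.≤-refl

-- Equality throughout the chain of bounds

module Sandwich where
  open import Data.Integer using (_+_; _-_; -_; _≤_)
  open import Data.Integer.Solver
  open +-*-Solver using (solve; _:+_; :-_; _:-_; _:=_)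

  -- Each of the three brackets equals the total minus the other two, so bounding those two from
  -- below bounds it from above.
  module Tightness (c bS bT dS dT Y Z : ℤ)
    (total : c + bS + bT ≤ Y + Z) (lowerS : Y ≤ bS - dS) (lowerT : Z ≤ bT + dT) (lowerF : 0ℤ ≤ c + dS - dT) where

    tightS : bS - dS ≤ Y
    tightS = subst₂ _≤_
      (solve 5 (λ c bS bT dS dT → c :+ bS :+ bT :+ (:- (bT :+ dT) :- (c :+ dS :- dT)) := bS :- dS) refl c bS bT dS dT)
      (solve 2 (λ Y Z → Y :+ Z :+ (:- Z) := Y) refl Y Z)
      (ℤ.+-mono-≤ total (ℤ.≤-trans (ℤ.+-mono-≤ (ℤ.neg-mono-≤ lowerT) (ℤ.neg-mono-≤ lowerF))
        (ℤ.≤-reflexive (ℤ.+-identityʳ (- Z)))))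

    tightT : bT + dT ≤ Z
    tightT = subst₂ _≤_
      (solve 5 (λ c bS bT dS dT → c :+ bS :+ bT :+ (:- (bS :- dS) :- (c :+ dS :- dT)) := bT :+ dT) refl c bS bT dS dT)
      (solve 2 (λ Y Z → Y :+ Z :+ (:- Y) := Z) refl Y Z)
      (ℤ.+-mono-≤ total (ℤ.≤-trans (ℤ.+-mono-≤ (ℤ.neg-mono-≤ lowerS) (ℤ.neg-mono-≤ lowerF))
        (ℤ.≤-reflexive (ℤ.+-identityʳ (- Y)))))

    tightF : c + dS - dT ≤ 0ℤ
    tightF = subst₂ _≤_
      (solve 5 (λ c bS bT dS dT → c :+ bS :+ bT :+ (:- (bS :- dS) :- (bT :+ dT)) := c :+ dS :- dT) refl c bS bT dS dT)
      (trans (solve 2 (λ Y Z → Y :+ Z :+ (:- Y :- Z) := Y :- Y) refl Y Z) (ℤ.+-inverseʳ Y))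
      (ℤ.+-mono-≤ total (ℤ.+-mono-≤ (ℤ.neg-mono-≤ lowerS) (ℤ.neg-mono-≤ lowerT)))

  combine : ∀ c cS cT dS dT {Y Z : ℤ} → Y ≤ cS - dS → Z ≤ cT + dT → 0ℤ ≤ c + dS - dT → Y + Z ≤ c + cS + cT
  combine c cS cT dS dT {Y} {Z} lowerS lowerT lowerF = subst₂ _≤_ (ℤ.+-identityʳ (Y + Z))
    (solve 5 (λ c cS cT dS dT → cS :- dS :+ (cT :+ dT) :+ (c :+ dS :- dT) := c :+ cS :+ cT) refl c cS cT dS dT)
    (ℤ.+-mono-≤ (ℤ.+-mono-≤ lowerS lowerT) lowerF)

  cancel-+ : ∀ {i j k : ℤ} → i + k ≤ j + k → i ≤ j
  cancel-+ {i} {j} {k} i+k≤j+k = subst₂ _≤_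
    (solve 2 (λ i k → i :+ k :+ (:- k) := i) refl i k) (solve 2 (λ i k → i :+ k :+ (:- k) := i) refl j k)
    (ℤ.+-monoˡ-≤ (- k) i+k≤j+k)

theorem4 : (G : Net) → Admissible G →
    (x : Fin′ G → Bool) → POptimal G (λ a → bℚ (x a)) →
    (y z : Subset (n G) → ℤ) → DOptimal G (λ X → toℚ (y X)) (λ X → toℚ (z X)) →
    OptimalFlow G x × OptimalPotential G (pStar G y) (qStar G z)
theorem4 G _ x x-optimal y z yz-optimal =
  (wB G BS , wB G BT , gS , gT , λ ξ cS cT gS′ gT′ →
    ℤ.≤-trans total (combine (flowCost G ξ) cS cT (dotS G p (∂ G ξ)) (dotT G q (∂⁻ G ξ))
      (GS-lower gS′) (GT-lower gT′) (lowerF ξ))) ,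
  (x , ((wB G BS , gS) , (wB G BT , gT)) , complementary ,
    (wB G BS , gS , λ η c g → ℤ.≤-trans tightS (GS-lower g)) ,
    (wB G BT , gT , λ ζ c g → ℤ.≤-trans tightT (GT-lower g)))
  where
  open Bounds G y z (proj₁ yz-optimal)
  open Boundary G x using (spanningS; spanningT; ∂-S; ∂⁻-T; degree-nonneg)
  open Sandwich
  open ∑ℤ

  coS : ∃[ B ] CobranchS G B (∂ G x) × (∀ a → B a ≡ true → x a ≡ true)
  coS = spanningS (proj₁ x-optimal)
  brT : ∃[ B ] BranchT G B (∂⁻ G x) × (∀ a → B a ≡ true → x a ≡ true)
  brT = spanningT (proj₁ x-optimal)

  BS BT : ArcSet G
  BS = proj₁ coS
  BT = proj₁ brT

  0≤∂ : ∀ v → inS G v ≡ true → 0ℤ ℤ.≤ ∂ G x v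
  0≤∂ v v∈S = subst (0ℤ ℤ.≤_) (sym (∂-S v v∈S)) (degree-nonneg (tl G) v)

  0≤∂⁻ : ∀ v → inT G v ≡ true → 0ℤ ℤ.≤ ∂⁻ G x v
  0≤∂⁻ v v∈T = subst (0ℤ ℤ.≤_) (sym (∂⁻-T v v∈T)) (degree-nonneg (hd G) v)

  lowerF : ∀ ξ → 0ℤ ℤ.≤ flowCost G ξ ℤ.+ dotS G p (∂ G ξ) ℤ.- dotT G q (∂⁻ G ξ)
  lowerF ξ = subst (0ℤ ℤ.≤_) (Boundary.flowCost-reduced G ξ p q) (∑-nonneg (allFin (m G)) (flowTerm-nonneg ξ))

  -- The flow arcs run from S to T, while `BS` stays inside S and `BT` inside T, so these are
  -- disjoint parts of `x` and together weigh at most w(x).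
  total : flowCost G x ℤ.+ wB G BS ℤ.+ wB G BT ℤ.≤ Y ℤ.+ Z
  total = ℤ.≤-trans (subst (ℤ._≤ Σℤ[ x ∣ (λ a → ℤ.+ w G a) ])
      (trans (∑-+ (allFin (m G)) _ _) (cong (ℤ._+ wB G BT) (∑-+ (allFin (m G)) _ _)))
      (∑-mono (allFin (m G)) parts))
    (integralDuality G x y z x-optimal yz-optimal)
    where
    parts : ∀ a → (if isST G a ∧ x a then ℤ.+ w G a else 0ℤ) ℤ.+ (if BS a then ℤ.+ w G a else 0ℤ)
      ℤ.+ (if BT a then ℤ.+ w G a else 0ℤ) ℤ.≤ (if x a then ℤ.+ w G a else 0ℤ)
    parts a = disjoint-≤ (ℤ.+≤+ ℕ.z≤n)
      (λ STx → proj₂ (∧-elim {isST G a} STx)) (proj₂ (proj₂ coS) a) (proj₂ (proj₂ brT) a)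
      (λ STx BSa → S∩T G (hd G a) (proj₂ (inBS BSa)) (hd∈T G a (proj₁ (∧-elim STx))))
      (λ STx BTa → S∩T G (tl G a) (tl∈S G a (proj₁ (∧-elim STx))) (proj₁ (inBT BTa)))
      (λ BSa BTa → S∩T G (tl G a) (proj₁ (inBS BSa)) (proj₁ (inBT BTa)))
      where
      inBS : BS a ≡ true → inS G (tl G a) ≡ true × inS G (hd G a) ≡ true
      inBS = proj₁ (proj₁ (proj₂ coS)) a
      inBT : BT a ≡ true → inT G (tl G a) ≡ true × inT G (hd G a) ≡ true
      inBT = proj₁ (proj₁ (proj₂ brT)) a

  lowerS′ : Y ℤ.≤ wB G BS ℤ.- dotS G p (∂ G x)
  lowerS′ = lowerS (∂ G x) 0≤∂ (proj₁ (proj₂ coS))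
  lowerT′ : Z ℤ.≤ wB G BT ℤ.+ dotT G q (∂⁻ G x)
  lowerT′ = lowerT (∂⁻ G x) 0≤∂⁻ (proj₁ (proj₂ brT))

  open Tightness (flowCost G x) (wB G BS) (wB G BT) (dotS G p (∂ G x)) (dotT G q (∂⁻ G x)) Y Z
    total lowerS′ lowerT′ (lowerF x)

  -- A competing cobranching has the same boundary, so the potential term agrees on both sides of
  -- the sandwich and cancels; this leaves a comparison of weights.
  gS : GS G (∂ G x) (wB G BS)
  gS = 0≤∂ , BS , proj₁ (proj₂ coS) , refl ,
    λ B′ cobranch → cancel-+ (ℤ.≤-trans tightS (lowerS (∂ G x) 0≤∂ cobranch))
  gT : GT G (∂⁻ G x) (wB G BT)
  gT = 0≤∂⁻ , BT , proj₁ (proj₂ brT) , refl ,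
    λ B′ branch → cancel-+ (ℤ.≤-trans tightT (lowerT (∂⁻ G x) 0≤∂⁻ branch))

  complementary : ∀ a → isST G a ≡ true →
    (x a ≡ true → reducedCost G p q a ℤ.≤ 0ℤ) ×
    (x a ≡ false → 0ℤ ℤ.≤ reducedCost G p q a)
  complementary a ST =
    -- The reduced costs on the flow are nonnegative and sum to at most 0, so no single one can
    -- exceed 0.
    (λ xa → subst (ℤ._≤ 0ℤ)
      (cong (λ e → if e then reducedCost G p q a else 0ℤ) (cong₂ _∧_ ST xa))
      (ℤ.≤-trans (term≤∑ (flowTerm-nonneg x) a)
        (subst (ℤ._≤ 0ℤ) (sym (Boundary.flowCost-reduced G x p q)) tightF))) ,
    λ _ → reducedCost-nonneg a ST
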